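{- Let $q\ge 6$ be a prime power, let $\mathcal V$ be a ruled quintic surface of $\mathrm{PG}(6,q)$, let $r\in\{3,4,5\}$ and let $\mathcal N_r$ be an $r$-dim nrc contained in $\mathcal V$. Then $\mathcal N_r$ contains exactly one point on each generator of $\mathcal V$.
   Context: Construction: in $\mathrm{PG}(6,q)$ let $\alpha$ be a plane and $\Pi_3$ a $3$-space with $\alpha\cap\Pi_3=\emptyset$. Let $\mathcal C$ be a non-degenerate conic in $\alpha$ and $\mathcal N_3$ a twisted cubic in $\Pi_3$, parametrised as $\mathcal C=\{(1,\theta,\theta^2)\}$ and $\mathcal N_3=\{(1,\epsilon,\epsilon^2,\epsilon^3)\}$ ($\theta,\epsilon\in\mathbb F_q\cup\{\infty\}$), and let $\phi\in\mathrm{PGL}(2,q)$ act on parameters, giving a bijection $\mathcal C\to\mathcal N_3$. The ruled quintic surface $\mathcal V$ is the set of points on the $q+1$ lines (generators) joining each point of $\mathcal C$ to its image under $\phi$. An $r$-dim nrc is a normal rational curve spanning an $r$-dimensional subspace. -}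

module Defs where

open import Data.Nat using (ℕ; zero; suc; _∸_)
open import Data.Fin using (Fin; zero; suc; toℕ)
open import Data.Sum using (_⊎_)
open import Data.Product using (Σ; ∃; _×_; _,_)
open import Relation.Nullary using (¬_)
open import Relation.Binary.PropositionalEquality using (_≡_)
open import Algebra.Structures using (IsCommutativeRing)
open import Function.Bundles using (_↔_)

-- A finite field with exactly q elements (equality is propositional).
-- (Any finite field has prime-power order, so q is automatically a prime power.)
record FiniteField (q : ℕ) : Set₁ where
  infixl 6 _+_
  infixl 7 _*_
  field
    F   : Set
    _+_ : F → F → F
    _*_ : F → F → F
    -_  : F → F
    0#  : F
    1#  : F
    isCommutativeRing : IsCommutativeRing _≡_ _+_ _*_ -_ 0# 1#
    0≢1     : ¬ (0# ≡ 1#)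
    inverse : ∀ x → ¬ (x ≡ 0#) → Σ F (λ y → x * y ≡ 1#)
    enum    : F ↔ Fin q

module Geometry {q : ℕ} (𝔽 : FiniteField q) where
  open FiniteField 𝔽

  _^_ : F → ℕ → F
  x ^ zero  = 1#
  x ^ suc n = x * (x ^ n)

  ∑ : ∀ {n} → (Fin n → F) → F
  ∑ {zero}  f = 0#
  ∑ {suc n} f = f zero + ∑ (λ i → f (suc i))

  -- Vectors of F^7 (homogeneous coordinates of PG(6,q)), indices 0..6.
  V7 : Set
  V7 = Fin 7 → F

  NonZero7 : V7 → Set
  NonZero7 v = Σ (Fin 7) (λ i → ¬ (v i ≡ 0#))

  SamePoint : V7 → V7 → Set
  SamePoint u v = Σ F (λ c → ¬ (c ≡ 0#) × (∀ i → u i ≡ c * v i))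

  -- Nonzero pair: homogeneous coordinates of a point of PG(1,q), i.e.
  -- a parameter in F ∪ {∞}; (1,θ) ↔ θ and (0,1) ↔ ∞.
  NonZero2 : F → F → Set
  NonZero2 s t = ¬ (s ≡ 0#) ⊎ ¬ (t ≡ 0#)

  conicPt : F → F → V7
  conicPt s t zero                         = s * s
  conicPt s t (suc zero)                   = s * t
  conicPt s t (suc (suc zero))             = t * t
  conicPt s t (suc (suc (suc _)))          = 0#

  cubicPt : F → F → V7
  cubicPt s t zero                                         = 0#
  cubicPt s t (suc zero)                                   = 0#
  cubicPt s t (suc (suc zero))                             = 0#
  cubicPt s t (suc (suc (suc zero)))                       = s * s * s
  cubicPt s t (suc (suc (suc (suc zero))))                 = s * s * t
  cubicPt s t (suc (suc (suc (suc (suc zero)))))           = s * t * t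
  cubicPt s t (suc (suc (suc (suc (suc (suc _))))))        = t * t * t

  record PGL2 : Set where
    field
      a b c d : F
      det≢0   : ¬ (a * d + - (b * c) ≡ 0#)

  module Surface (φ : PGL2) where
    open PGL2 φ

    φs φt : F → F → F
    φs s t = a * s + b * t
    φt s t = c * s + d * t

    -- The point (vector) p lies on the generator of 𝒱 with parameter (s,t),
    -- i.e. the line joining C(s,t) and N3(φ(s,t)).
    OnGenerator : F → F → V7 → Set
    OnGenerator s t p =
      Σ F (λ λ₁ → Σ F (λ μ →
        ∀ i → p i ≡ λ₁ * conicPt s t i + μ * cubicPt (φs s t) (φt s t) i))

    OnV : V7 → Set
    OnV p = Σ F (λ s → Σ F (λ t → NonZero2 s t × OnGenerator s t p))

  LinIndep : ∀ {m} → (Fin m → V7) → Set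
  LinIndep {m} v = ∀ (κ : Fin m → F) →
    (∀ j → ∑ (λ i → κ i * v i j) ≡ 0#) → ∀ i → κ i ≡ 0#

  -- An r-dim normal rational curve: given r+1 linearly independent vectors
  -- v₀,…,v_r (spanning an r-space), its points are
  --   ⟨ Σ_i s^(r-i) t^i v_i ⟩,  (s,t) ≠ (0,0).
  nrcPt : (r : ℕ) → (Fin (suc r) → V7) → F → F → V7
  nrcPt r v s t j = ∑ (λ i → (s ^ (r ∸ toℕ i)) * (t ^ toℕ i) * v i j)

{-# OPTIONS --safe #-}
module Submission where

-- Suppose two points of the curve lie on the generator g with parameter (s₀ , t₀), and choose
-- linear forms l, l′ in the parameter of a generator with l(s₀ , t₀) = 0 ≠ l′(s₀ , t₀). Since
-- r ≤ 5, some non-zero functional h vanishes on the curve. At the point λ C + μ N of the generator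
-- (s , t) it takes the value λ f(s , t) + μ k(s , t) with f quadratic and k cubic. As h vanishes
-- on g, both f and k are divisible by l, and replacing one factor l by l′ gives a functional which
-- vanishes at every point of the curve off g. At most two points of the curve are on g, so these
-- are at least q − 1 ≥ r + 1 points, and the new functional vanishes on the whole curve too.
-- Repeating this forces f = k = 0. Hence every generator carries at most one point of the curve,
-- and by counting exactly one.
--
-- This needs q ≥ 7, so a field of order 6 has to be excluded: if 1 + 1 = 0, additive subgroups can
-- be doubled up to order 8, and otherwise sets closed under negation grow by two up to size 7.

open import Defs
open import Data.Nat as ℕ using (ℕ; zero; suc; z≤n; s≤s; _≤_; _<_)
import Data.Nat.Properties as ℕ
open import Data.Fin as Fin using (Fin; zero; suc; punchIn; punchOut)
import Data.Fin.Properties as Fin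
open import Data.Fin.Patterns using (0F; 1F; 2F; 3F; 4F; 5F; 6F)
open import Data.Product using (Σ; ∃; _×_; _,_; proj₁; proj₂)
open import Data.Sum using (_⊎_; inj₁; inj₂)
open import Data.Maybe using (Maybe; just; nothing)
open import Data.Empty using (⊥; ⊥-elim)
open import Data.Vec.Functional using (_∷_; [])
open import Relation.Nullary using (¬_; Dec; yes; no; contradiction)
open import Relation.Nullary.Decidable using (map′; ¬?; decidable-stable)
open import Relation.Binary.PropositionalEquality
  using (_≡_; _≢_; refl; sym; trans; cong; cong₂; subst; subst₂; module ≡-Reasoning)
open import Function using (_∘_)
open import Function.Bundles using (Inverse)
open import Algebra.Bundles using (CommutativeRing; RawRing)
open import Algebra.Solver.Ring.AlmostCommutativeRing using (_-Raw-AlmostCommutative⟶_; fromCommutativeRing)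
import Algebra.Solver.Ring
import Algebra.Properties.Ring
import Algebra.Properties.Semiring.Mult
open import Level using (0ℓ)
open import Data.List as List using (List; length; _++_; map) renaming ([] to []ᴸ; _∷_ to _∷ᴸ_)
open import Data.List.Membership.Propositional using (_∈_; _∉_)
open import Data.List.Membership.Propositional.Properties using (∈-++⁺ˡ; ∈-++⁺ʳ; ∈-++⁻; ∈-map⁺; ∈-map⁻; ∈-lookup)
import Data.List.Membership.DecPropositional
open import Data.List.Relation.Unary.Any as Any using (here; there)
import Data.List.Relation.Unary.Any.Properties as Any
import Data.List.Relation.Unary.All as All
import Data.List.Relation.Unary.All.Properties as All
import Data.List.Relation.Unary.AllPairs as AllPairs
open import Data.List.Relation.Unary.Unique.Propositional using (Unique)
open import Data.List.Relation.Unary.Unique.Propositional.Properties using (++⁺; map⁺)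

-- A polynomial identity solver over a commutative ring, with integer coefficients

module IntegerSolver (R : CommutativeRing 0ℓ 0ℓ) where
  open CommutativeRing R hiding (refl; sym; trans)
  private module R = CommutativeRing R
  open Algebra.Properties.Ring ring
  open Algebra.Properties.Semiring.Mult semiring using (×-homo-+; ×1-homo-*) renaming (_×_ to _⋆_)
  open import Relation.Binary.Reasoning.Setoid setoid
  open import Algebra.Solver.Ring.NaturalCoefficients.Default commutativeSemiring
    using () renaming (solve to solveℕ; _:=_ to _⊜_; _:+_ to _⊕_; _:*_ to _⊗_)

  -- The pair (a , b) stands for the integer a − b.
  differences : RawRing 0ℓ 0ℓ
  differences = record
    { Carrier = ℕ × ℕ
    ; _≈_ = _≡_
    ; _+_ = λ (a , b) (c , d) → a ℕ.+ c , b ℕ.+ d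
    ; _*_ = λ (a , b) (c , d) → a ℕ.* c ℕ.+ b ℕ.* d , a ℕ.* d ℕ.+ b ℕ.* c
    ; -_ = λ (a , b) → b , a
    ; 0# = 0 , 0
    ; 1# = 1 , 0
    }

  ι : ℕ → Carrier
  ι n = n ⋆ 1#

  diff : ℕ × ℕ → Carrier
  diff (a , b) = ι a - ι b

  ι-+ : ∀ m n → ι (m ℕ.+ n) ≈ ι m + ι n
  ι-+ = ×-homo-+ 1#

  -- Needed for `_≟ᶜ_`: the integers a - b and c - d are compared through the natural numbers a + d
  -- and c + b.
  cancel-minus : ∀ {a b c d} → a + d ≈ c + b → a - b ≈ c - d
  cancel-minus {a} {b} {c} {d} e = begin
    a - b              ≈⟨ +-congʳ (+-identityʳ a) ⟨
    (a + 0#) - b       ≈⟨ +-congʳ (+-congˡ (-‿inverseʳ d)) ⟨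
    (a + (d - d)) - b  ≈⟨ solveℕ 4 (λ a d e b → (a ⊕ (d ⊕ e)) ⊕ b ⊜ (a ⊕ d) ⊕ (e ⊕ b)) R.refl a d (- d) (- b) ⟩
    (a + d) + (- d - b) ≈⟨ +-congʳ e ⟩
    (c + b) + (- d - b) ≈⟨ solveℕ 4 (λ c b e f → (c ⊕ b) ⊕ (e ⊕ f) ⊜ (c ⊕ e) ⊕ (b ⊕ f)) R.refl c b (- d) (- b) ⟩
    (c - d) + (b - b)  ≈⟨ +-congˡ (-‿inverseʳ b) ⟩
    (c - d) + 0#       ≈⟨ +-identityʳ _ ⟩
    c - d              ∎

  minus-distrib-+ : ∀ a b → - (a + b) ≈ - a + - b
  minus-distrib-+ a b = R.sym (-‿+-comm a b)

  diff-+ : ∀ x y → diff (RawRing._+_ differences x y) ≈ diff x + diff y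
  diff-+ (a , b) (c , d) = begin
    ι (a ℕ.+ c) - ι (b ℕ.+ d)         ≈⟨ +-cong (ι-+ a c) (-‿cong (ι-+ b d)) ⟩
    (ι a + ι c) - (ι b + ι d)         ≈⟨ +-congˡ (minus-distrib-+ _ _) ⟩
    (ι a + ι c) + (- ι b + - ι d)     ≈⟨ solveℕ 4 (λ a c b d → (a ⊕ c) ⊕ (b ⊕ d) ⊜ (a ⊕ b) ⊕ (c ⊕ d)) R.refl (ι a) (ι c) (- ι b) (- ι d) ⟩
    (ι a - ι b) + (ι c - ι d)         ∎

  ι-mul₂ : ∀ a b c d → ι (a ℕ.* b ℕ.+ c ℕ.* d) ≈ ι a * ι b + ι c * ι d
  ι-mul₂ a b c d = R.trans (ι-+ (a ℕ.* b) (c ℕ.* d)) (+-cong (×1-homo-* a b) (×1-homo-* c d))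

  diff-* : ∀ x y → diff (RawRing._*_ differences x y) ≈ diff x * diff y
  diff-* (a , b) (c , d) = begin
    ι (a ℕ.* c ℕ.+ b ℕ.* d) - ι (a ℕ.* d ℕ.+ b ℕ.* c)
      ≈⟨ +-cong (ι-mul₂ a c b d) (-‿cong (ι-mul₂ a d b c)) ⟩
    (A * C + B * D) - (A * D + B * C)
      ≈⟨ +-cong (+-congˡ B*D) (R.trans (minus-distrib-+ _ _) (+-cong (-‿distribʳ-* A D) (-‿distribˡ-* B C))) ⟩
    (A * C + - B * - D) + (A * - D + - B * C)
      ≈⟨ solveℕ 4 (λ A B C D → (A ⊗ C ⊕ B ⊗ D) ⊕ (A ⊗ D ⊕ B ⊗ C) ⊜ (A ⊕ B) ⊗ (C ⊕ D)) R.refl A (- B) C (- D) ⟩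
    (A - B) * (C - D) ∎
    where
    A = ι a
    B = ι b
    C = ι c
    D = ι d
    B*D : B * D ≈ - B * - D
    B*D = begin
      B * D         ≈⟨ -‿involutive _ ⟨
      - - (B * D)   ≈⟨ -‿cong (-‿distribʳ-* B D) ⟩
      - (B * - D)   ≈⟨ -‿distribˡ-* B (- D) ⟩
      - B * - D     ∎

  diff-neg : ∀ a b → diff (b , a) ≈ - diff (a , b)
  diff-neg a b = R.trans (+-comm _ _) (R.trans (+-congˡ (R.sym (-‿involutive _))) (-‿+-comm _ _))

  -- Agrees with diff; the first two clauses make the constants 0 and 1 of the solver mean
  -- literally 0# and 1#.
  value : ℕ × ℕ → Carrier
  value (0 , 0) = 0#
  value (1 , 0) = 1#
  value x = diff x

  value≈diff : ∀ x → value x ≈ diff x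
  value≈diff (0 , 0) = R.sym (-‿inverseʳ 0#)
  value≈diff (1 , 0) =
    R.sym (R.trans (+-congʳ (+-identityʳ 1#)) (R.trans (+-congˡ -0#≈0#) (+-identityʳ 1#)))
  value≈diff (0 , suc _) = R.refl
  value≈diff (1 , suc _) = R.refl
  value≈diff (suc (suc _) , _) = R.refl

  homomorphism : differences -Raw-AlmostCommutative⟶ fromCommutativeRing R
  homomorphism = record
    { ⟦_⟧ = value
    ; +-homo = λ x y → R.trans (value≈diff (RawRing._+_ differences x y))
        (R.trans (diff-+ x y) (R.sym (+-cong (value≈diff x) (value≈diff y))))
    ; *-homo = λ x y → R.trans (value≈diff (RawRing._*_ differences x y))
        (R.trans (diff-* x y) (R.sym (*-cong (value≈diff x) (value≈diff y))))
    ; -‿homo = λ x@(a , b) → R.trans (value≈diff (b , a)) (R.trans (diff-neg a b) (R.sym (-‿cong (value≈diff x))))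
    ; 0-homo = R.refl
    ; 1-homo = R.refl
    }

  -- Coefficients are compared as integers. Different integers may still agree in the ring, so a
  -- negative answer proves nothing and `nothing` is returned.
  _≟ᶜ_ : ∀ x y → Maybe (value x ≈ value y)
  x@(a , b) ≟ᶜ y@(c , d) with a ℕ.+ d ℕ.≟ c ℕ.+ b
  ... | no _ = nothing
  ... | yes e = just (R.trans (value≈diff x) (R.trans
    (cancel-minus (R.trans (R.sym (ι-+ a d)) (R.trans (R.reflexive (cong ι e)) (ι-+ c b))))
    (R.sym (value≈diff y))))

  open Algebra.Solver.Ring differences (fromCommutativeRing R) homomorphism _≟ᶜ_ public
    using (Polynomial; solve; _:=_; _:+_; _:*_; :-_; con)

  𝟘 𝟙 : ∀ {n} → Polynomial n
  𝟘 = con (0 , 0)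
  𝟙 = con (1 , 0)

-- Enumeration and decidable equality of a finite field

module FieldLemmas {q : ℕ} (𝔽 : FiniteField q) where
  open FiniteField 𝔽

  commutativeRing : CommutativeRing 0ℓ 0ℓ
  commutativeRing = record { isCommutativeRing = isCommutativeRing }

  open CommutativeRing commutativeRing public
    using (+-assoc; +-comm; +-identityˡ; +-identityʳ; *-assoc; *-comm; *-identityˡ; *-identityʳ;
           zeroˡ; zeroʳ; distribˡ; -‿inverseʳ; ring)
  open IntegerSolver commutativeRing public using (solve; _:=_; _:+_; _:*_; :-_; 𝟘; 𝟙)

  index : F → Fin q
  index = Inverse.to enum

  elem : Fin q → F
  elem = Inverse.from enum

  elem-index : ∀ x → elem (index x) ≡ x
  elem-index x = Inverse.strictlyInverseʳ enum x

  index-elem : ∀ i → index (elem i) ≡ i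
  index-elem i = Inverse.strictlyInverseˡ enum i

  index-injective : ∀ {x y} → index x ≡ index y → x ≡ y
  index-injective {x} {y} e = trans (sym (elem-index x)) (trans (cong elem e) (elem-index y))

  infix 4 _≟_
  _≟_ : (x y : F) → Dec (x ≡ y)
  x ≟ y = map′ index-injective (cong index) (index x Fin.≟ index y)

-- Linear algebra: finite sums, homogeneous systems, the homogeneous Vandermonde argument

module LinearAlgebra {q : ℕ} (𝔽 : FiniteField q) where
  open FiniteField 𝔽
  open Geometry 𝔽
  open FieldLemmas 𝔽
  open ≡-Reasoning

  unscale : ∀ {k k⁻¹ x y} → k * k⁻¹ ≡ 1# → x ≡ k * y → y ≡ k⁻¹ * x
  unscale {k} {k⁻¹} {x} {y} kk⁻¹≡1 e = begin
    y               ≡⟨ *-identityˡ y ⟨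
    1# * y          ≡⟨ cong (_* y) kk⁻¹≡1 ⟨
    k * k⁻¹ * y     ≡⟨ solve 3 (λ k l y → k :* l :* y := l :* (k :* y)) refl k k⁻¹ y ⟩
    k⁻¹ * (k * y)   ≡⟨ cong (k⁻¹ *_) e ⟨
    k⁻¹ * x         ∎

  x*y≡0⇒y≡0 : ∀ {x y} → x ≢ 0# → x * y ≡ 0# → y ≡ 0#
  x*y≡0⇒y≡0 {x} {y} x≢0 xy≡0 with inverse x x≢0
  ... | x⁻¹ , xx⁻¹≡1 = trans (unscale xx⁻¹≡1 (sym xy≡0)) (zeroʳ x⁻¹)

  *-nonzero : ∀ {x y} → x ≢ 0# → y ≢ 0# → x * y ≢ 0#
  *-nonzero x≢0 y≢0 = y≢0 ∘ x*y≡0⇒y≡0 x≢0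

  ^-nonzero : ∀ {x} n → x ≢ 0# → x ^ n ≢ 0#
  ^-nonzero zero x≢0 = 0≢1 ∘ sym
  ^-nonzero (suc n) x≢0 = *-nonzero x≢0 (^-nonzero n x≢0)

  ∑-cong : ∀ {n} {f g : Fin n → F} → (∀ i → f i ≡ g i) → ∑ f ≡ ∑ g
  ∑-cong {zero} e = refl
  ∑-cong {suc n} e = cong₂ _+_ (e zero) (∑-cong (e ∘ suc))

  ∑-zero : ∀ {n} {f : Fin n → F} → (∀ i → f i ≡ 0#) → ∑ f ≡ 0#
  ∑-zero {zero} e = refl
  ∑-zero {suc n} e = trans (cong₂ _+_ (e zero) (∑-zero (e ∘ suc))) (+-identityˡ 0#)

  ∑-+ : ∀ {n} (f g : Fin n → F) → ∑ (λ i → f i + g i) ≡ ∑ f + ∑ g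
  ∑-+ {zero} f g = sym (+-identityˡ 0#)
  ∑-+ {suc n} f g = trans (cong (f zero + g zero +_) (∑-+ (f ∘ suc) (g ∘ suc)))
    (solve 4 (λ a b c d → a :+ b :+ (c :+ d) := a :+ c :+ (b :+ d)) refl (f zero) (g zero) _ _)

  ∑-*ˡ : ∀ {n} k (f : Fin n → F) → ∑ (λ i → k * f i) ≡ k * ∑ f
  ∑-*ˡ {zero} k f = sym (zeroʳ k)
  ∑-*ˡ {suc n} k f = trans (cong (k * f zero +_) (∑-*ˡ k (f ∘ suc))) (sym (distribˡ k _ _))

  ∑-*ʳ : ∀ {n} (f : Fin n → F) k → ∑ (λ i → f i * k) ≡ ∑ f * k
  ∑-*ʳ f k = trans (∑-cong (λ i → *-comm (f i) k)) (trans (∑-*ˡ k f) (*-comm k (∑ f)))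

  ∑-linear : ∀ {n} a b (f g : Fin n → F) → ∑ (λ i → a * f i + b * g i) ≡ a * ∑ f + b * ∑ g
  ∑-linear a b f g = trans (∑-+ (λ i → a * f i) (λ i → b * g i)) (cong₂ _+_ (∑-*ˡ a f) (∑-*ˡ b g))

  ∑-swap : ∀ {m n} (f : Fin m → Fin n → F) →
           ∑ (λ i → ∑ (λ j → f i j)) ≡ ∑ (λ j → ∑ (λ i → f i j))
  ∑-swap {zero} {n} f = sym (∑-zero {n} (λ _ → refl))
  ∑-swap {suc m} f = trans (cong (∑ (f zero) +_) (∑-swap (f ∘ suc))) (sym (∑-+ (f zero) _))

  -- Gaussian elimination without division. If the first column is zero, the first unit vector is a
  -- solution. Otherwise a row with non-zero first entry clears the first unknown from the other
  -- rows by cross-multiplication, and the smaller system is solved by induction.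
  homogeneous-system : ∀ {m n} → m < n → (M : Fin m → Fin n → F) →
    Σ (Fin n → F) λ x → (∃ λ k → x k ≢ 0#) × (∀ i → ∑ (λ j → M i j * x j) ≡ 0#)
  homogeneous-system {m} {suc n} m<n M with Fin.any? (λ i → ¬? (M i zero ≟ 0#))
  ... | no M₀≡0 = (1# ∷ λ _ → 0#) , (zero , 0≢1 ∘ sym) , λ i →
    trans (cong₂ _+_ (cong (_* 1#) (decidable-stable (M i zero ≟ 0#) (λ ≢0 → M₀≡0 (i , ≢0))))
                     (∑-zero (λ j → zeroʳ (M i (suc j)))))
          (trans (+-identityʳ _) (zeroˡ 1#))
  homogeneous-system {suc m} {suc n} (s≤s m<n) M | yes (i , pivot≢0)
    with homogeneous-system m<n (λ k j → M i zero * M (punchIn i k) (suc j)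
                                         + - M (punchIn i k) zero * M i (suc j))
  ... | y , (k , yₖ≢0) , sol = x , (suc k , *-nonzero pivot≢0 yₖ≢0) , solution
    where
    p : F
    p = M i zero
    S : Fin (suc m) → F
    S k = ∑ (λ j → M k (suc j) * y j)
    -- The solution of the smaller system is multiplied by the pivot, so that the first unknown
    -- forced by the pivot row is `- S i`, without a quotient.
    x : Fin (suc n) → F
    x = - S i ∷ λ j → p * y j
    row : ∀ k → ∑ (λ j → M k j * x j) ≡ p * S k + - M k zero * S i
    row k = begin
      M k zero * - S i + ∑ (λ j → M k (suc j) * (p * y j))
        ≡⟨ cong (M k zero * - S i +_)
             (trans (∑-cong (λ j → solve 3 (λ a p b → a :* (p :* b) := p :* (a :* b)) refl (M k (suc j)) p (y j)))
                    (∑-*ˡ p (λ j → M k (suc j) * y j))) ⟩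
      M k zero * - S i + p * S k
        ≡⟨ solve 4 (λ a b p c → a :* :- b :+ p :* c := p :* c :+ :- a :* b) refl (M k zero) (S i) p (S k) ⟩
      p * S k + - M k zero * S i ∎
    eliminated : ∀ k → p * S (punchIn i k) + - M (punchIn i k) zero * S i ≡ 0#
    eliminated k = begin
      p * S k′ + - M k′ zero * S i
        ≡⟨ ∑-linear p (- M k′ zero) (λ j → M k′ (suc j) * y j) (λ j → M i (suc j) * y j) ⟨
      ∑ (λ j → p * (M k′ (suc j) * y j) + - M k′ zero * (M i (suc j) * y j))
        ≡⟨ ∑-cong (λ j → solve 5 (λ p a c b y → p :* (a :* y) :+ :- c :* (b :* y) := (p :* a :+ :- c :* b) :* y)
                           refl p (M k′ (suc j)) (M k′ zero) (M i (suc j)) (y j)) ⟩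
      ∑ (λ j → (p * M k′ (suc j) + - M k′ zero * M i (suc j)) * y j)
        ≡⟨ sol k ⟩
      0# ∎
      where k′ = punchIn i k
    solution : ∀ k → ∑ (λ j → M k j * x j) ≡ 0#
    solution k with i Fin.≟ k
    ... | yes refl = trans (row i) (solve 2 (λ p s → p :* s :+ :- p :* s := 𝟘) refl p (S i))
    ... | no i≢k = subst (λ k → ∑ (λ j → M k j * x j) ≡ 0#) (Fin.punchIn-punchOut i≢k)
                     (trans (row _) (eliminated _))

  -- The determinant with rows (s , t) and (s′ , t′). For non-zero pairs it vanishes exactly when
  -- they are the same point of the projective line.
  bracket : F → F → F → F → F
  bracket s t s′ t′ = s * t′ + - (t * s′)

  module _ {n} (κ s t : Fin n → F) where
    moment : ℕ → ℕ → F
    moment a b = ∑ (λ j → κ j * (s j ^ a * t j ^ b))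

  -- Homogeneous form of the Vandermonde determinant, which treats the parameter ∞ like the others.
  -- Multiplying each coefficient by its bracket with the first parameter removes the first term and
  -- lowers the degree by one, so by induction the other coefficients vanish. A pure power of a
  -- non-zero coordinate then gives the first one.
  vandermonde : ∀ n m → n ≤ suc m → (κ s t : Fin n → F) →
    (∀ j → NonZero2 (s j) (t j)) →
    (∀ i j → i ≢ j → bracket (s i) (t i) (s j) (t j) ≢ 0#) →
    (∀ a b → a ℕ.+ b ≡ m → moment κ s t a b ≡ 0#) →
    ∀ j → κ j ≡ 0#
  vandermonde (suc n) m n<m κ s t nonzero distinct moments = λ where
      zero → head (nonzero zero)
      (suc j) → tail m n<m moments j
    where
    tail : ∀ m → suc n ≤ suc m → (∀ a b → a ℕ.+ b ≡ m → moment κ s t a b ≡ 0#) →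
           ∀ j → κ (suc j) ≡ 0#
    tail zero (s≤s z≤n) moments ()
    tail (suc m) (s≤s n≤m) moments j =
      x*y≡0⇒y≡0 (distinct (suc j) zero λ ()) (trans (*-comm _ _)
        (vandermonde n m n≤m (κ′ ∘ suc) (s ∘ suc) (t ∘ suc) (nonzero ∘ suc)
          (λ i j i≢j → distinct (suc i) (suc j) (i≢j ∘ Fin.suc-injective)) moments′ j))
      where
      κ′ : Fin (suc n) → F
      κ′ j = κ j * bracket (s j) (t j) (s zero) (t zero)
      moments′ : ∀ a b → a ℕ.+ b ≡ m → moment (κ′ ∘ suc) (s ∘ suc) (t ∘ suc) a b ≡ 0#
      moments′ a b e = begin
        moment (κ′ ∘ suc) (s ∘ suc) (t ∘ suc) a b
          -- The first term may be added back, because the bracket of the first parameter with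
          -- itself is zero.
          ≡⟨ solve 5 (λ k s t r m → m := k :* (s :* t :+ :- (t :* s)) :* r :+ m) refl
               (κ zero) (s zero) (t zero) (s zero ^ a * t zero ^ b) _ ⟩
        moment κ′ s t a b
          ≡⟨ ∑-cong (λ j → solve 7 (λ k s t x y A B → k :* (s :* y :+ :- (t :* x)) :* (A :* B)
                               := y :* (k :* (s :* A :* B)) :+ :- x :* (k :* (A :* (t :* B))))
                             refl (κ j) (s j) (t j) (s zero) (t zero) (s j ^ a) (t j ^ b)) ⟩
        ∑ (λ j → t zero * (κ j * (s j ^ suc a * t j ^ b)) + - s zero * (κ j * (s j ^ a * t j ^ suc b)))
          ≡⟨ ∑-linear (t zero) (- s zero) (λ j → κ j * (s j ^ suc a * t j ^ b)) (λ j → κ j * (s j ^ a * t j ^ suc b)) ⟩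
        t zero * moment κ s t (suc a) b + - s zero * moment κ s t a (suc b)
          ≡⟨ cong₂ (λ x y → t zero * x + - s zero * y) (moments (suc a) b (cong suc e))
               (moments a (suc b) (trans (ℕ.+-suc a b) (cong suc e))) ⟩
        t zero * 0# + - s zero * 0#
          ≡⟨ solve 2 (λ x y → x :* 𝟘 :+ :- y :* 𝟘 := 𝟘) refl (t zero) (s zero) ⟩
        0# ∎
    first : ∀ a b → a ℕ.+ b ≡ m → κ zero * (s zero ^ a * t zero ^ b) ≡ 0#
    first a b e = begin
      κ zero * (s zero ^ a * t zero ^ b)       ≡⟨ +-identityʳ _ ⟨
      κ zero * (s zero ^ a * t zero ^ b) + 0#  ≡⟨ cong (κ zero * (s zero ^ a * t zero ^ b) +_)
        (∑-zero (λ j → trans (cong (_* _) (tail m n<m moments j)) (zeroˡ _))) ⟨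
      moment κ s t a b                         ≡⟨ moments a b e ⟩
      0#                                       ∎
    head : NonZero2 (s zero) (t zero) → κ zero ≡ 0#
    head (inj₁ s≢0) = x*y≡0⇒y≡0 (*-nonzero (^-nonzero m s≢0) (0≢1 ∘ sym))
      (trans (*-comm _ _) (first m 0 (ℕ.+-identityʳ m)))
    head (inj₂ t≢0) = x*y≡0⇒y≡0 (*-nonzero (0≢1 ∘ sym) (^-nonzero m t≢0))
      (trans (*-comm _ _) (first 0 m refl))

-- A field of order at least 6 has order at least 7

module FieldOrder {q : ℕ} (𝔽 : FiniteField q) where
  open FiniteField 𝔽
  open FieldLemmas 𝔽
  open LinearAlgebra 𝔽
  open Algebra.Properties.Ring ring using (-‿involutive; +-cancelˡ)
  open Data.List.Membership.DecPropositional _≟_ using (_∈?_)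
  open ≡-Reasoning

  -- Pigeonhole: if every field element occurred in `xs`, its position there would inject `Fin q`
  -- into the positions of a shorter list.
  fresh : (xs : List F) → length xs < q → ∃ λ x → x ∉ xs
  fresh xs |xs|<q with Fin.any? (λ i → ¬? (elem i ∈? xs))
  ... | yes (i , ∉xs) = elem i , ∉xs
  ... | no none = contradiction (Fin.injective⇒≤ position-injective) (ℕ.<⇒≱ |xs|<q)
    where
    member : ∀ i → elem i ∈ xs
    member i = decidable-stable (elem i ∈? xs) (λ ∉xs → none (i , ∉xs))
    position-injective : ∀ {i j} → Any.index (member i) ≡ Any.index (member j) → i ≡ j
    position-injective {i} {j} e = begin
      i                                                ≡⟨ index-elem i ⟨
      index (elem i)                                   ≡⟨ cong index (Any.lookup-index (member i)) ⟩
      index (List.lookup xs (Any.index (member i)))    ≡⟨ cong (index ∘ List.lookup xs) e ⟩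
      index (List.lookup xs (Any.index (member j)))    ≡⟨ cong index (Any.lookup-index (member j)) ⟨
      index (elem j)                                   ≡⟨ index-elem j ⟩
      j                                                ∎

  length≤order : ∀ {xs} → Unique xs → length xs ≤ q
  length≤order {xs} unique = Fin.injective⇒≤ {f = index ∘ List.lookup xs}
    (lookup-injective unique _ _ ∘ index-injective)
    where
    lookup-injective : ∀ {xs : List F} → Unique xs → ∀ i j → List.lookup xs i ≡ List.lookup xs j → i ≡ j
    lookup-injective (x∉ AllPairs.∷ u) zero zero e = refl
    lookup-injective (x∉ AllPairs.∷ u) zero (suc j) e = contradiction e (All.lookup x∉ (∈-lookup j))
    lookup-injective (x∉ AllPairs.∷ u) (suc i) zero e = contradiction (sym e) (All.lookup x∉ (∈-lookup i))
    lookup-injective (x∉ AllPairs.∷ u) (suc i) (suc j) e = cong suc (lookup-injective u i j e)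

  module _ (1+1≡0 : 1# + 1# ≡ 0#) where
    -- Closure under addition suffices, since in characteristic two every element is its own
    -- negative.
    Subgroup : List F → Set
    Subgroup xs = Unique xs × (∀ {x y} → x ∈ xs → y ∈ xs → x + y ∈ xs)

    x+x≡0 : ∀ x → x + x ≡ 0#
    x+x≡0 x = begin
      x + x            ≡⟨ solve 1 (λ x → x :+ x := x :* (𝟙 :+ 𝟙)) refl x ⟩
      x * (1# + 1#)    ≡⟨ cong (x *_) 1+1≡0 ⟩
      x * 0#           ≡⟨ zeroʳ x ⟩
      0#               ∎

    x+[y+y]≡x : ∀ x y → x + (y + y) ≡ x
    x+[y+y]≡x x y = trans (cong (x +_) (x+x≡0 y)) (+-identityʳ x)

    -- Adjoins the coset of an element z outside the subgroup. It is disjoint from the subgroup,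
    -- because x = z + y would give z = x + y; a sum of two coset elements falls back into the
    -- subgroup because z + z = 0.
    enlarge-subgroup : ∀ xs → Subgroup xs → length xs < q → ∃ λ z → Subgroup (xs ++ map (z +_) xs)
    enlarge-subgroup xs (unique , closed) small with fresh xs small
    ... | z , z∉xs = z , ++⁺ unique (map⁺ (+-cancelˡ z _ _) unique) disjoint ,
      λ x∈ y∈ → closed′ (∈-++⁻ xs x∈) (∈-++⁻ xs y∈)
      where
      shifted : ∀ {x} → x ∈ map (z +_) xs → ∃ λ y → y ∈ xs × x ≡ z + y
      shifted = ∈-map⁻ (z +_)
      disjoint : ∀ {x} → ¬ (x ∈ xs × x ∈ map (z +_) xs)
      disjoint (x∈ , x∈′) with shifted x∈′
      ... | y , y∈ , refl = z∉xs (subst (_∈ xs) (trans (+-assoc z y y) (x+[y+y]≡x z y)) (closed x∈ y∈))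
      closed′ : ∀ {x y} → x ∈ xs ⊎ x ∈ map (z +_) xs → y ∈ xs ⊎ y ∈ map (z +_) xs →
                x + y ∈ xs ++ map (z +_) xs
      closed′ (inj₁ x∈) (inj₁ y∈) = ∈-++⁺ˡ (closed x∈ y∈)
      closed′ {x} (inj₁ x∈) (inj₂ y∈) with shifted y∈
      ... | y′ , y′∈ , refl = ∈-++⁺ʳ xs (subst (_∈ map (z +_) xs)
        (solve 3 (λ x y z → z :+ (x :+ y) := x :+ (z :+ y)) refl x y′ z) (∈-map⁺ (z +_) (closed x∈ y′∈)))
      closed′ {y = y} (inj₂ x∈) (inj₁ y∈) with shifted x∈
      ... | x′ , x′∈ , refl = ∈-++⁺ʳ xs (subst (_∈ map (z +_) xs)
        (sym (+-assoc z x′ y)) (∈-map⁺ (z +_) (closed x′∈ y∈)))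
      closed′ (inj₂ x∈) (inj₂ y∈) with shifted x∈ | shifted y∈
      ... | x′ , x′∈ , refl | y′ , y′∈ , refl = ∈-++⁺ˡ (subst (_∈ xs)
        (trans (sym (x+[y+y]≡x (x′ + y′) z))
               (solve 3 (λ x y z → x :+ y :+ (z :+ z) := z :+ x :+ (z :+ y)) refl x′ y′ z))
        (closed x′∈ y′∈))

    -- The trivial subgroup is doubled three times; the last doubling needs an element outside a
    -- subgroup of order 4.
    8≤order : 5 ≤ q → 8 ≤ q
    8≤order 4<q =
      let G₁ : Subgroup (0# ∷ᴸ []ᴸ)
          G₁ = All.[] AllPairs.∷ AllPairs.[] , λ where (here refl) (here refl) → here (+-identityˡ 0#)
          _ , G₂ = enlarge-subgroup _ G₁ (ℕ.≤-trans (ℕ.m≤m+n 2 3) 4<q)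
          _ , G₄ = enlarge-subgroup _ G₂ (ℕ.≤-trans (ℕ.m≤m+n 3 2) 4<q)
          _ , G₈ = enlarge-subgroup _ G₄ 4<q
      in length≤order (proj₁ G₈)

  module _ (1+1≢0 : 1# + 1# ≢ 0#) where
    Symmetric : List F → Set
    Symmetric xs = Unique xs × 0# ∈ xs × (∀ {x} → x ∈ xs → - x ∈ xs)

    x≡-x⇒x≡0 : ∀ {x} → x ≡ - x → x ≡ 0#
    x≡-x⇒x≡0 {x} e = x*y≡0⇒y≡0 1+1≢0 (begin
      (1# + 1#) * x   ≡⟨ solve 1 (λ x → (𝟙 :+ 𝟙) :* x := x :+ x) refl x ⟩
      x + x           ≡⟨ cong (x +_) e ⟩
      x + - x         ≡⟨ -‿inverseʳ x ⟩
      0#              ∎)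

    -- A new z differs from - z, since otherwise z = 0 would already be in the list. Also - z is
    -- new, as the list is closed under negation.
    enlarge-symmetric : ∀ xs → Symmetric xs → length xs < q → ∃ λ z → Symmetric (z ∷ᴸ - z ∷ᴸ xs)
    enlarge-symmetric xs (unique , 0∈xs , closed) small with fresh xs small
    ... | z , z∉xs = z ,
      ((λ e → z∉xs (subst (_∈ xs) (sym (x≡-x⇒x≡0 e)) 0∈xs)) All.∷ All.¬Any⇒All¬ xs z∉xs)
        AllPairs.∷ All.¬Any⇒All¬ xs (λ -z∈ → z∉xs (subst (_∈ xs) (-‿involutive z) (closed -z∈)))
        AllPairs.∷ unique ,
      there (there 0∈xs) ,
      λ where
        (here refl) → there (here refl)
        (there (here refl)) → here (-‿involutive z)
        (there (there x∈)) → there (there (closed x∈))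

    -- The sizes are 1, 3, 5, 7, starting from the list containing only zero.
    7≤order : 6 ≤ q → 7 ≤ q
    7≤order 5<q =
      let S₁ : Symmetric (0# ∷ᴸ []ᴸ)
          S₁ = All.[] AllPairs.∷ AllPairs.[] , here refl ,
               λ where (here refl) → here (solve 0 (:- 𝟘 := 𝟘) refl)
          _ , S₃ = enlarge-symmetric _ S₁ (ℕ.≤-trans (ℕ.m≤m+n 2 4) 5<q)
          _ , S₅ = enlarge-symmetric _ S₃ (ℕ.≤-trans (ℕ.m≤m+n 4 2) 5<q)
          _ , S₇ = enlarge-symmetric _ S₅ 5<q
      in length≤order (proj₁ S₇)

  6≤order⇒7≤order : 6 ≤ q → 7 ≤ q
  6≤order⇒7≤order 6≤q with 1# + 1# ≟ 0#
  ... | yes 1+1≡0 = ℕ.≤-trans (ℕ.n≤1+n 7) (8≤order 1+1≡0 (ℕ.≤-trans (ℕ.n≤1+n 5) 6≤q))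
  ... | no 1+1≢0 = 7≤order 1+1≢0 6≤q

-- Normalised parameters on the projective line, and equality of projective points

module ProjectiveLine {q : ℕ} (𝔽 : FiniteField q) where
  open FiniteField 𝔽
  open Geometry 𝔽
  open FieldLemmas 𝔽
  open LinearAlgebra 𝔽
  open ≡-Reasoning

  -- Index `zero` stands for ∞ = (0 , 1) and `suc i` for (1 , θ) with θ the i-th field element. Each
  -- of the q + 1 parameters has one index, which makes them countable.
  pointₛ pointₜ : Fin (suc q) → F
  pointₛ zero = 0#
  pointₛ (suc i) = 1#
  pointₜ zero = 1#
  pointₜ (suc i) = elem i

  point-nonzero : ∀ i → NonZero2 (pointₛ i) (pointₜ i)
  point-nonzero zero = inj₂ (0≢1 ∘ sym)
  point-nonzero (suc i) = inj₁ (0≢1 ∘ sym)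

  bracket≡0⇒same-point : ∀ i j → bracket (pointₛ i) (pointₜ i) (pointₛ j) (pointₜ j) ≡ 0# → i ≡ j
  bracket≡0⇒same-point zero zero e = refl
  bracket≡0⇒same-point zero (suc j) e = contradiction (begin
    0#                            ≡⟨ solve 0 (𝟘 := :- 𝟘) refl ⟩
    - 0#                          ≡⟨ cong -_ e ⟨
    - (0# * elem j + - (1# * 1#)) ≡⟨ solve 1 (λ t → :- (𝟘 :* t :+ :- (𝟙 :* 𝟙))
                                                      := 𝟙) refl (elem j) ⟩
    1#                            ∎) 0≢1
  bracket≡0⇒same-point (suc i) zero e = contradiction (begin
    0#                            ≡⟨ e ⟨
    1# * 1# + - (elem i * 0#)     ≡⟨ solve 1 (λ t → 𝟙 :* 𝟙 :+ :- (t :* 𝟘)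
                                                      := 𝟙) refl (elem i) ⟩
    1#                            ∎) 0≢1
  bracket≡0⇒same-point (suc i) (suc j) e = cong suc (begin
    i               ≡⟨ index-elem i ⟨
    index (elem i)  ≡⟨ cong index (begin
      elem i                                          ≡⟨ +-identityˡ _ ⟨
      0# + elem i                                     ≡⟨ cong (_+ elem i) e ⟨
      (1# * elem j + - (elem i * 1#)) + elem i        ≡⟨ solve 2 (λ x y → 𝟙 :* y :+ :- (x :* 𝟙) :+ x := y)
                                                           refl (elem i) (elem j) ⟩
      elem j                                          ∎) ⟩
    index (elem j)  ≡⟨ index-elem j ⟩
    j               ∎)

  point-distinct : ∀ i j → i ≢ j → bracket (pointₛ i) (pointₜ i) (pointₛ j) (pointₜ j) ≢ 0#
  point-distinct i j i≢j = i≢j ∘ bracket≡0⇒same-point i j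

  normalise : ∀ {s t} → NonZero2 s t →
    ∃ λ i → ∃ λ k → k ≢ 0# × s ≡ k * pointₛ i × t ≡ k * pointₜ i
  normalise {s} {t} nonzero with s ≟ 0#
  normalise {s} {t} (inj₁ s≢0) | yes s≡0 = contradiction s≡0 s≢0
  normalise {s} {t} (inj₂ t≢0) | yes s≡0 =
    zero , t , t≢0 , trans s≡0 (sym (zeroʳ t)) , sym (*-identityʳ t)
  normalise {s} {t} _ | no s≢0 with inverse s s≢0
  ... | s⁻¹ , ss⁻¹≡1 = suc (index (s⁻¹ * t)) , s , s≢0 , sym (*-identityʳ s) , (begin
    t                              ≡⟨ *-identityˡ t ⟨
    1# * t                         ≡⟨ cong (_* t) ss⁻¹≡1 ⟨
    s * s⁻¹ * t                    ≡⟨ *-assoc s s⁻¹ t ⟩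
    s * (s⁻¹ * t)                  ≡⟨ cong (s *_) (elem-index (s⁻¹ * t)) ⟨
    s * elem (index (s⁻¹ * t))     ∎)

  SamePoint-sym : ∀ {p p′} → SamePoint p p′ → SamePoint p′ p
  SamePoint-sym {p} {p′} (k , k≢0 , e) with inverse k k≢0
  ... | k⁻¹ , kk⁻¹≡1 = k⁻¹ , k⁻¹≢0 , λ i → unscale kk⁻¹≡1 (e i)
    where
    k⁻¹≢0 : k⁻¹ ≢ 0#
    k⁻¹≢0 refl = 0≢1 (trans (sym (zeroʳ k)) kk⁻¹≡1)

  SamePoint-trans : ∀ {p p′ p″} → SamePoint p p′ → SamePoint p′ p″ → SamePoint p p″
  SamePoint-trans {p″ = p″} (k , k≢0 , e) (k′ , k′≢0 , e′) = k * k′ , *-nonzero k≢0 k′≢0 ,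
    λ i → trans (e i) (trans (cong (k *_) (e′ i)) (sym (*-assoc k k′ (p″ i))))

-- Linear functionals and their values on the conic and the twisted cubic

module Functionals {q : ℕ} (𝔽 : FiniteField q) where
  open FiniteField 𝔽
  open Geometry 𝔽
  open FieldLemmas 𝔽
  open LinearAlgebra 𝔽
  open ≡-Reasoning

  dot : V7 → V7 → F
  dot w p = ∑ (λ k → w k * p k)

  dot-∑ : ∀ {n} w (κ : Fin n → F) (P : Fin n → V7) {p} →
          (∀ c → p c ≡ ∑ (λ j → κ j * P j c)) → dot w p ≡ ∑ (λ j → κ j * dot w (P j))
  dot-∑ w κ P {p} e = begin
    ∑ (λ c → w c * p c)                        ≡⟨ ∑-cong (λ c → trans (cong (w c *_) (e c)) (sym (∑-*ˡ (w c) (λ j → κ j * P j c)))) ⟩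
    ∑ (λ c → ∑ (λ j → w c * (κ j * P j c)))    ≡⟨ ∑-swap (λ c j → w c * (κ j * P j c)) ⟩
    ∑ (λ j → ∑ (λ c → w c * (κ j * P j c)))    ≡⟨ ∑-cong (λ j → trans
      (∑-cong (λ c → solve 3 (λ w k p → w :* (k :* p) := k :* (w :* p)) refl (w c) (κ j) (P j c)))
      (∑-*ˡ (κ j) (λ c → w c * P j c))) ⟩
    ∑ (λ j → κ j * dot w (P j))                ∎

  dot-combination : ∀ w a b (P Q : V7) {p} → (∀ c → p c ≡ a * P c + b * Q c) →
                    dot w p ≡ a * dot w P + b * dot w Q
  dot-combination w a b P Q {p} e = begin
    ∑ (λ c → w c * p c)                            ≡⟨ ∑-cong (λ c → trans (cong (w c *_) (e c))
      (solve 5 (λ w a b p q → w :* (a :* p :+ b :* q) := a :* (w :* p) :+ b :* (w :* q)) refl (w c) a b (P c) (Q c))) ⟩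
    ∑ (λ c → a * (w c * P c) + b * (w c * Q c))    ≡⟨ ∑-linear a b (λ c → w c * P c) (λ c → w c * Q c) ⟩
    a * dot w P + b * dot w Q                      ∎

  -- The functionals taking the values (α s + β t) (γ s + δ t) on the conic and
  -- (α s + β t) (γ s + δ t) (ε s + ζ t) on the twisted cubic.
  quadratic : F → F → F → F → V7
  quadratic α β γ δ = α * γ ∷ α * δ + β * γ ∷ β * δ ∷ 0# ∷ 0# ∷ 0# ∷ 0# ∷ []

  cubic : F → F → F → F → F → F → V7
  cubic α β γ δ ε ζ =
    0# ∷ 0# ∷ 0# ∷ α * γ * ε ∷ α * γ * ζ + α * δ * ε + β * γ * ε ∷
    α * δ * ζ + β * γ * ζ + β * δ * ε ∷ β * δ * ζ ∷ []

  -- In this and the next three identities the left side is `dot` written out over all seven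
  -- coordinates, zeros included, so that it matches by reduction.
  quadratic-conic : ∀ α β γ δ s t →
    dot (quadratic α β γ δ) (conicPt s t) ≡ (α * s + β * t) * (γ * s + δ * t)
  quadratic-conic = solve 6 (λ α β γ δ s t →
    α :* γ :* (s :* s) :+ ((α :* δ :+ β :* γ) :* (s :* t) :+ (β :* δ :* (t :* t) :+
      (𝟘 :* 𝟘 :+ (𝟘 :* 𝟘 :+ (𝟘 :* 𝟘 :+ (𝟘 :* 𝟘 :+ 𝟘))))))
    := (α :* s :+ β :* t) :* (γ :* s :+ δ :* t)) refl

  quadratic-cubic : ∀ α β γ δ s t → dot (quadratic α β γ δ) (cubicPt s t) ≡ 0#
  quadratic-cubic = solve 6 (λ α β γ δ s t →
    α :* γ :* 𝟘 :+ ((α :* δ :+ β :* γ) :* 𝟘 :+ (β :* δ :* 𝟘 :+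
      (𝟘 :* (s :* s :* s) :+ (𝟘 :* (s :* s :* t) :+ (𝟘 :* (s :* t :* t) :+ (𝟘 :* (t :* t :* t) :+ 𝟘))))))
    := 𝟘) refl

  cubic-conic : ∀ α β γ δ ε ζ s t → dot (cubic α β γ δ ε ζ) (conicPt s t) ≡ 0#
  cubic-conic = solve 8 (λ α β γ δ ε ζ s t →
    𝟘 :* (s :* s) :+ (𝟘 :* (s :* t) :+ (𝟘 :* (t :* t) :+
      (α :* γ :* ε :* 𝟘 :+ ((α :* γ :* ζ :+ α :* δ :* ε :+ β :* γ :* ε) :* 𝟘 :+
      ((α :* δ :* ζ :+ β :* γ :* ζ :+ β :* δ :* ε) :* 𝟘 :+ (β :* δ :* ζ :* 𝟘 :+ 𝟘))))))
    := 𝟘) refl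

  cubic-cubic : ∀ α β γ δ ε ζ s t → dot (cubic α β γ δ ε ζ) (cubicPt s t) ≡
    (α * s + β * t) * (γ * s + δ * t) * (ε * s + ζ * t)
  cubic-cubic = solve 8 (λ α β γ δ ε ζ s t →
    𝟘 :* 𝟘 :+ (𝟘 :* 𝟘 :+ (𝟘 :* 𝟘 :+
      (α :* γ :* ε :* (s :* s :* s) :+ ((α :* γ :* ζ :+ α :* δ :* ε :+ β :* γ :* ε) :* (s :* s :* t) :+
      ((α :* δ :* ζ :+ β :* γ :* ζ :+ β :* δ :* ε) :* (s :* t :* t) :+ (β :* δ :* ζ :* (t :* t :* t) :+ 𝟘))))))
    := (α :* s :+ β :* t) :* (γ :* s :+ δ :* t) :* (ε :* s :+ ζ :* t)) refl

-- Normal rational curves: homogeneity and independence of points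

module NormalRationalCurve {q : ℕ} (𝔽 : FiniteField q) {r : ℕ}
  (v : Fin (suc r) → Geometry.V7 𝔽) where
  open FiniteField 𝔽
  open Geometry 𝔽
  open FieldLemmas 𝔽
  open LinearAlgebra 𝔽
  open ProjectiveLine 𝔽
  open Functionals 𝔽
  open ≡-Reasoning

  monomial : F → F → Fin (suc r) → F
  monomial s t i = s ^ (r ℕ.∸ Fin.toℕ i) * t ^ Fin.toℕ i

  curvePoint : Fin (suc q) → V7
  curvePoint j = nrcPt r v (pointₛ j) (pointₜ j)

  -- Collects a combination of curve points along the vectors `v i`; the coefficients become sums of
  -- monomial values, to which the Vandermonde argument applies.
  nrcPt-combination : ∀ {n} (κ s t : Fin n → F) c →
    ∑ (λ j → κ j * nrcPt r v (s j) (t j) c) ≡ ∑ (λ i → ∑ (λ j → κ j * monomial (s j) (t j) i) * v i c)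
  nrcPt-combination κ s t c = begin
    ∑ (λ j → κ j * ∑ (λ i → A i j * v i c))        ≡⟨ ∑-cong (λ j → ∑-*ˡ (κ j) (λ i → A i j * v i c)) ⟨
    ∑ (λ j → ∑ (λ i → κ j * (A i j * v i c)))      ≡⟨ ∑-swap (λ j i → κ j * (A i j * v i c)) ⟩
    ∑ (λ i → ∑ (λ j → κ j * (A i j * v i c)))      ≡⟨ ∑-cong (λ i → trans
      (∑-cong (λ j → sym (*-assoc (κ j) (A i j) (v i c)))) (∑-*ʳ (λ j → κ j * A i j) (v i c))) ⟩
    ∑ (λ i → ∑ (λ j → κ j * A i j) * v i c)        ∎
    where
    A : Fin (suc r) → _ → F
    A i j = monomial (s j) (t j) i

  *-^ : ∀ x y n → (x * y) ^ n ≡ x ^ n * y ^ n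
  *-^ x y zero = sym (*-identityˡ 1#)
  *-^ x y (suc n) = trans (cong (x * y *_) (*-^ x y n))
    (solve 4 (λ x y X Y → x :* y :* (X :* Y) := x :* X :* (y :* Y)) refl x y (x ^ n) (y ^ n))

  ^-+ : ∀ x m n → x ^ (m ℕ.+ n) ≡ x ^ m * x ^ n
  ^-+ x zero n = sym (*-identityˡ _)
  ^-+ x (suc m) n = trans (cong (x *_) (^-+ x m n)) (sym (*-assoc x (x ^ m) (x ^ n)))

  nrcPt-scale : ∀ k s t c → nrcPt r v (k * s) (k * t) c ≡ k ^ r * nrcPt r v s t c
  nrcPt-scale k s t c = trans (∑-cong term) (∑-*ˡ (k ^ r) (λ i → monomial s t i * v i c))
    where
    term : ∀ i → monomial (k * s) (k * t) i * v i c ≡ k ^ r * (monomial s t i * v i c)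
    term i = begin
      (k * s) ^ m * (k * t) ^ n * v i c
        ≡⟨ cong (_* v i c) (cong₂ _*_ (*-^ k s m) (*-^ k t n)) ⟩
      k ^ m * s ^ m * (k ^ n * t ^ n) * v i c
        ≡⟨ solve 5 (λ K S L T u → K :* S :* (L :* T) :* u := K :* L :* (S :* T :* u)) refl
             (k ^ m) (s ^ m) (k ^ n) (t ^ n) (v i c) ⟩
      k ^ m * k ^ n * (s ^ m * t ^ n * v i c)
        ≡⟨ cong (_* (s ^ m * t ^ n * v i c)) (^-+ k m n) ⟨
      k ^ (m ℕ.+ n) * (s ^ m * t ^ n * v i c)
        ≡⟨ cong (λ e → k ^ e * (s ^ m * t ^ n * v i c)) (ℕ.m∸n+n≡m (Fin.toℕ≤pred[n] i)) ⟩
      k ^ r * (s ^ m * t ^ n * v i c) ∎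
      where
      n = Fin.toℕ i
      m = r ℕ.∸ n

  nrcPt-cong : ∀ {s s′ t t′} → s ≡ s′ → t ≡ t′ → ∀ c → nrcPt r v s t c ≡ nrcPt r v s′ t′ c
  nrcPt-cong refl refl c = refl

  nrcPt-normalise : ∀ {s t} → NonZero2 s t → ∃ λ i → SamePoint (nrcPt r v s t) (curvePoint i)
  nrcPt-normalise nonzero with normalise nonzero
  ... | i , k , k≢0 , s≡ , t≡ = i , k ^ r , ^-nonzero r k≢0 ,
    λ c → trans (nrcPt-cong s≡ t≡ c) (nrcPt-scale k (pointₛ i) (pointₜ i) c)

  Injective : ∀ {n} → (Fin n → Fin (suc q)) → Set
  Injective ρ = ∀ {i j} → ρ i ≡ ρ j → i ≡ j

  moments-independent : ∀ {n} → n ≤ suc r → (ρ : Fin n → Fin (suc q)) → Injective ρ → (κ : Fin n → F) →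
    (∀ i → ∑ (λ j → κ j * monomial (pointₛ (ρ j)) (pointₜ (ρ j)) i) ≡ 0#) →
    ∀ j → κ j ≡ 0#
  moments-independent {n} n≤ ρ inj κ moments =
    vandermonde n r n≤ κ (pointₛ ∘ ρ) (pointₜ ∘ ρ) (point-nonzero ∘ ρ)
      (λ i j i≢j → point-distinct (ρ i) (ρ j) (i≢j ∘ inj)) moments′
    where
    moments′ : ∀ a b → a ℕ.+ b ≡ r → moment κ (pointₛ ∘ ρ) (pointₜ ∘ ρ) a b ≡ 0#
    -- The monomial with exponents a and b has index b, since index i carries the exponents r - i
    -- and i.
    moments′ a b refl = subst₂ (λ a b → moment κ (pointₛ ∘ ρ) (pointₜ ∘ ρ) a b ≡ 0#)
      (trans (cong (a ℕ.+ b ℕ.∸_) toℕi≡b) (ℕ.m+n∸n≡m a b)) toℕi≡b (moments i)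
      where
      b<1+r : b < suc (a ℕ.+ b)
      b<1+r = s≤s (ℕ.m≤n+m b a)
      i : Fin (suc (a ℕ.+ b))
      i = Fin.fromℕ< b<1+r
      toℕi≡b : Fin.toℕ i ≡ b
      toℕi≡b = Fin.toℕ-fromℕ< b<1+r

  -- Independence of the `v i` reduces a relation between the points to one between their monomial
  -- vectors, which are independent by `moments-independent`.
  curvePoints-independent : LinIndep v → ∀ {n} → n ≤ suc r → (ρ : Fin n → Fin (suc q)) → Injective ρ →
    LinIndep (curvePoint ∘ ρ)
  curvePoints-independent lin n≤ ρ inj κ relation = moments-independent n≤ ρ inj κ
    (lin _ (λ c → trans (sym (nrcPt-combination κ (pointₛ ∘ ρ) (pointₜ ∘ ρ) c)) (relation c)))

  -- Any r + 2 points of the curve are dependent, any r + 1 of them are not: so the first of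
  -- r + 2 points is a combination of the others.
  vanishing-propagates : ∀ w (ρ : Fin (suc r) → Fin (suc q)) → Injective ρ →
    (∀ j → dot w (curvePoint (ρ j)) ≡ 0#) → ∀ b → dot w (curvePoint b) ≡ 0#
  vanishing-propagates w ρ inj vanish b
    with homogeneous-system {suc r} {suc (suc r)} ℕ.≤-refl
           (λ i j → monomial (pointₛ ((b ∷ ρ) j)) (pointₜ ((b ∷ ρ) j)) i)
  ... | κ , (k , κₖ≢0) , sol = x*y≡0⇒y≡0 κ₀≢0 (begin
    κ zero * dot w (curvePoint b)
      ≡⟨ +-identityʳ _ ⟨
    κ zero * dot w (curvePoint b) + 0#
      ≡⟨ cong (κ zero * dot w (curvePoint b) +_) (∑-zero (λ j → trans (cong (κ (suc j) *_) (vanish j)) (zeroʳ (κ (suc j))))) ⟨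
    ∑ (λ j → κ j * dot w (curvePoint ((b ∷ ρ) j)))
      ≡⟨ dot-∑ w κ (curvePoint ∘ (b ∷ ρ)) relation ⟨
    dot w (λ _ → 0#)
      ≡⟨ ∑-zero (λ c → zeroʳ (w c)) ⟩
    0# ∎)
    where
    s t : Fin (suc (suc r)) → F
    s = pointₛ ∘ (b ∷ ρ)
    t = pointₜ ∘ (b ∷ ρ)
    μ : Fin (suc r) → Fin (suc (suc r)) → F
    μ i j = monomial (s j) (t j) i
    moments : ∀ i → ∑ (λ j → κ j * μ i j) ≡ 0#
    moments i = trans (∑-cong (λ j → *-comm (κ j) (μ i j))) (sol i)
    relation : ∀ c → 0# ≡ ∑ (λ j → κ j * curvePoint ((b ∷ ρ) j) c)
    relation c = sym (trans (nrcPt-combination κ s t c)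
      (∑-zero (λ i → trans (cong (_* v i c) (moments i)) (zeroˡ (v i c)))))
    -- If this coefficient were zero, the remaining ones would give a relation between the r + 1
    -- monomial vectors at the distinct parameters `ρ`. The argument also covers the case that `b`
    -- is one of the `ρ j`.
    κ₀≢0 : κ zero ≢ 0#
    κ₀≢0 κ₀≡0 = κₖ≢0 (all-zero k)
      where
      rest : ∀ i → ∑ (λ j → κ (suc j) * μ i (suc j)) ≡ 0#
      rest i = begin
        ∑ (λ j → κ (suc j) * μ i (suc j))         ≡⟨ +-identityˡ (∑ (λ j → κ (suc j) * μ i (suc j))) ⟨
        0# + ∑ (λ j → κ (suc j) * μ i (suc j))    ≡⟨ cong (_+ ∑ (λ j → κ (suc j) * μ i (suc j)))
          (trans (cong (_* μ i zero) κ₀≡0) (zeroˡ (μ i zero))) ⟨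
        ∑ (λ j → κ j * μ i j)                     ≡⟨ moments i ⟩
        0#                                        ∎
      all-zero : ∀ j → κ j ≡ 0#
      all-zero zero = κ₀≡0
      all-zero (suc j) = moments-independent ℕ.≤-refl ρ inj (κ ∘ suc) rest j

-- Generators of the surface, and functionals adapted to one of them

module Generators {q : ℕ} (𝔽 : FiniteField q) (φ : Geometry.PGL2 𝔽) where
  open FiniteField 𝔽
  open Geometry 𝔽
  open Surface φ
  open PGL2 φ
  open FieldLemmas 𝔽
  open LinearAlgebra 𝔽
  open ProjectiveLine 𝔽
  open Functionals 𝔽
  open ≡-Reasoning

  -- The conic is homogeneous of degree 2 and the twisted cubic of degree 3, so the two coefficients
  -- absorb k² and k³.
  OnGenerator-scale : ∀ k {s t s′ t′ p} → s ≡ k * s′ → t ≡ k * t′ → OnGenerator s t p → OnGenerator s′ t′ p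
  OnGenerator-scale k {s′ = s} {t′ = t} {p} refl refl (λ₁ , μ , e) =
    λ₁ * (k * k) , μ * (k * k * k) , λ i → trans (e i) (begin
      λ₁ * conicPt (k * s) (k * t) i + μ * cubicPt (φs (k * s) (k * t)) (φt (k * s) (k * t)) i
        ≡⟨ cong₂ (λ x y → λ₁ * x + μ * y) (conic-scale s t i)
             (trans (cong₂ (λ x y → cubicPt x y i) (linear-scale a b) (linear-scale c d)) (cubic-scale (φs s t) (φt s t) i)) ⟩
      λ₁ * (k * k * conicPt s t i) + μ * (k * k * k * cubicPt (φs s t) (φt s t) i)
        ≡⟨ cong₂ _+_ (*-assoc λ₁ (k * k) _) (*-assoc μ (k * k * k) _) ⟨
      λ₁ * (k * k) * conicPt s t i + μ * (k * k * k) * cubicPt (φs s t) (φt s t) i ∎)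
    where
    linear-scale : ∀ α β → α * (k * s) + β * (k * t) ≡ k * (α * s + β * t)
    linear-scale α β = solve 5 (λ k s t α β → α :* (k :* s) :+ β :* (k :* t) := k :* (α :* s :+ β :* t)) refl k s t α β
    square : ∀ x y → k * x * (k * y) ≡ k * k * (x * y)
    square = solve 3 (λ k x y → k :* x :* (k :* y) := k :* k :* (x :* y)) refl k
    cube : ∀ x y z → k * x * (k * y) * (k * z) ≡ k * k * k * (x * y * z)
    cube = solve 4 (λ k x y z → k :* x :* (k :* y) :* (k :* z) := k :* k :* k :* (x :* y :* z)) refl k
    conic-scale : ∀ s t i → conicPt (k * s) (k * t) i ≡ k * k * conicPt s t i
    conic-scale s t 0F = square s s
    conic-scale s t 1F = square s t
    conic-scale s t 2F = square t t
    conic-scale s t (suc (suc (suc _))) = sym (zeroʳ (k * k))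
    cubic-scale : ∀ s t i → cubicPt (k * s) (k * t) i ≡ k * k * k * cubicPt s t i
    cubic-scale s t 0F = sym (zeroʳ (k * k * k))
    cubic-scale s t 1F = sym (zeroʳ (k * k * k))
    cubic-scale s t 2F = sym (zeroʳ (k * k * k))
    cubic-scale s t 3F = cube s s s
    cubic-scale s t 4F = cube s s t
    cubic-scale s t 5F = cube s t t
    cubic-scale s t 6F = cube t t t

  OnGenerator-respects : ∀ {s t p p′} → SamePoint p p′ → OnGenerator s t p → OnGenerator s t p′
  OnGenerator-respects {s} {t} {p} {p′} same (λ₁ , μ , e) with SamePoint-sym {p} {p′} same
  ... | k , _ , e′ = k * λ₁ , k * μ , λ i → trans (e′ i) (trans (cong (k *_) (e i))
    (solve 5 (λ k x y C N → k :* (x :* C :+ y :* N) := k :* x :* C :+ k :* y :* N) refl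
       k λ₁ μ (conicPt s t i) (cubicPt (φs s t) (φt s t) i)))

  OnV⇒OnGenerator : ∀ {p} → OnV p → ∃ λ g → OnGenerator (pointₛ g) (pointₜ g) p
  OnV⇒OnGenerator (s , t , nonzero , on) with normalise nonzero
  ... | g , k , _ , es , et = g , OnGenerator-scale k es et on

  module _ (s t : F) where
    -- With `det-t`, multiplication by the adjugate of the matrix of φ; hence φ sends no non-zero
    -- pair to zero.
    det-s : (a * d + - (b * c)) * s ≡ d * φs s t + - b * φt s t
    det-s = solve 6 (λ a b c d s t → (a :* d :+ :- (b :* c)) :* s
      := d :* (a :* s :+ b :* t) :+ :- b :* (c :* s :+ d :* t)) refl a b c d s t

    det-t : (a * d + - (b * c)) * t ≡ - c * φs s t + a * φt s t
    det-t = solve 6 (λ a b c d s t → (a :* d :+ :- (b :* c)) :* t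
      := :- c :* (a :* s :+ b :* t) :+ a :* (c :* s :+ d :* t)) refl a b c d s t

  module _ {s t : F} (S≡0 : φs s t ≡ 0#) (T≡0 : φt s t ≡ 0#) where
    combination≡0 : ∀ x y → x * φs s t + y * φt s t ≡ 0#
    combination≡0 x y = begin
      x * φs s t + y * φt s t   ≡⟨ cong₂ (λ S T → x * S + y * T) S≡0 T≡0 ⟩
      x * 0# + y * 0#           ≡⟨ cong₂ _+_ (zeroʳ x) (zeroʳ y) ⟩
      0# + 0#                   ≡⟨ +-identityˡ 0# ⟩
      0#                        ∎

    φ≡0⇒s≡0 : s ≡ 0#
    φ≡0⇒s≡0 = x*y≡0⇒y≡0 det≢0 (trans (det-s s t) (combination≡0 d (- b)))

    φ≡0⇒t≡0 : t ≡ 0#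
    φ≡0⇒t≡0 = x*y≡0⇒y≡0 det≢0 (trans (det-t s t) (combination≡0 (- c) a))

  φ-never-zero : ∀ s t → NonZero2 s t → φs s t ≡ 0# → φt s t ≡ 0# → ⊥
  φ-never-zero s t (inj₁ s≢0) S≡0 T≡0 = s≢0 (φ≡0⇒s≡0 S≡0 T≡0)
  φ-never-zero s t (inj₂ t≢0) S≡0 T≡0 = t≢0 (φ≡0⇒t≡0 S≡0 T≡0)

  φ-nonzero′ : ∀ s t → NonZero2 s t → Dec (φs s t ≡ 0#) → Dec (φt s t ≡ 0#) → NonZero2 (φs s t) (φt s t)
  φ-nonzero′ s t nonzero (no S≢0) _ = inj₁ S≢0
  φ-nonzero′ s t nonzero (yes _) (no T≢0) = inj₂ T≢0
  φ-nonzero′ s t nonzero (yes S≡0) (yes T≡0) = ⊥-elim (φ-never-zero s t nonzero S≡0 T≡0)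

  φ-nonzero : ∀ s t → NonZero2 s t → NonZero2 (φs s t) (φt s t)
  φ-nonzero s t nonzero = φ-nonzero′ s t nonzero (φs s t ≟ 0#) (φt s t ≟ 0#)

  -- Supplies the form l′ that does not vanish at the chosen generator; a coordinate form is enough.
  transverse-form : ∀ {S T} → NonZero2 S T → ∃ λ x → ∃ λ y → x * S + y * T ≢ 0#
  transverse-form {S} {T} (inj₁ S≢0) = 1# , 0# , λ e → S≢0 (begin
    S                 ≡⟨ +-identityʳ S ⟨
    S + 0#            ≡⟨ cong₂ _+_ (*-identityˡ S) (zeroˡ T) ⟨
    1# * S + 0# * T   ≡⟨ e ⟩
    0#                ∎)
  transverse-form {S} {T} (inj₂ T≢0) = 0# , 1# , λ e → T≢0 (begin
    T                 ≡⟨ +-identityˡ T ⟨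
    0# + T            ≡⟨ cong₂ _+_ (zeroˡ S) (*-identityˡ T) ⟨
    0# * S + 1# * T   ≡⟨ e ⟩
    0#                ∎)

  -- The linear form (s , t) ↦ α S + β T, where (S , T) = φ (s , t), vanishes at one parameter
  -- on the conic and at the corresponding one on the twisted cubic.
  form : F → F → F → F → F
  form α β s t = α * φs s t + β * φt s t

  -- Identifies the form l attached to the parameter (s₀ , t₀): up to the factor - det it is the
  -- bracket with that parameter, so it vanishes there and at no other point of the line.
  form-bracket : ∀ s₀ t₀ s t →
    form (φt s₀ t₀) (- φs s₀ t₀) s t ≡ - (a * d + - (b * c)) * bracket s₀ t₀ s t
  form-bracket s₀ t₀ s t = solve 8 (λ a b c d s₀ t₀ s t →
    (c :* s₀ :+ d :* t₀) :* (a :* s :+ b :* t) :+ :- (a :* s₀ :+ b :* t₀) :* (c :* s :+ d :* t)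
    := :- (a :* d :+ :- (b :* c)) :* (s₀ :* t :+ :- (t₀ :* s))) refl a b c d s₀ t₀ s t

  module Basis (α β γ δ : F) where
    l l′ : F → F → F
    l = form α β
    l′ = form γ δ

    -- The quadratic forms l′², l l′, l² and the cubic forms l′³, l l′², l² l′, l³.
    basis : Fin 7 → V7
    basis = quadratic C D C D ∷ quadratic A B C D ∷ quadratic A B A B ∷
            cubic γ δ γ δ γ δ ∷ cubic α β γ δ γ δ ∷ cubic α β α β γ δ ∷ cubic α β α β α β ∷ []
      where
      -- The conic is parametrised by (s , t) but the forms are written in (S , T) = φ (s , t).
      -- These are the coefficients of l and l′ after substituting φ; the cubics need no
      -- substitution.
      A = α * a + β * c
      B = α * b + β * d
      C = γ * a + δ * c
      D = γ * b + δ * d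

    functional : (Fin 7 → F) → V7
    functional x i = ∑ (λ k → x k * basis k i)

    dot-functional : ∀ x p → dot (functional x) p ≡ ∑ (λ k → x k * dot (basis k) p)
    dot-functional x p = begin
      dot (functional x) p                ≡⟨ ∑-cong (λ i → *-comm (functional x i) (p i)) ⟩
      dot p (functional x)                ≡⟨ dot-∑ p x basis (λ _ → refl) ⟩
      ∑ (λ k → x k * dot p (basis k))     ≡⟨ ∑-cong (λ k → cong (x k *_) (∑-cong (λ i → *-comm (p i) (basis k i)))) ⟩
      ∑ (λ k → x k * dot (basis k) p)     ∎

    dot-quadratic : ∀ {p s t λ₁ μ} α β γ δ →
      (∀ i → p i ≡ λ₁ * conicPt s t i + μ * cubicPt (φs s t) (φt s t) i) →
      dot (quadratic (α * a + β * c) (α * b + β * d) (γ * a + δ * c) (γ * b + δ * d)) p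
        ≡ λ₁ * (form α β s t * form γ δ s t)
    dot-quadratic {p} {s} {t} {λ₁} {μ} α β γ δ e = begin
      dot w p
        ≡⟨ dot-combination w λ₁ μ (conicPt s t) (cubicPt (φs s t) (φt s t)) e ⟩
      λ₁ * dot w (conicPt s t) + μ * dot w (cubicPt (φs s t) (φt s t))
        ≡⟨ cong₂ (λ x y → λ₁ * x + μ * y) (quadratic-conic A B C D s t) (quadratic-cubic A B C D (φs s t) (φt s t)) ⟩
      λ₁ * ((A * s + B * t) * (C * s + D * t)) + μ * 0#
        ≡⟨ trans (cong (λ₁ * ((A * s + B * t) * (C * s + D * t)) +_) (zeroʳ μ)) (+-identityʳ _) ⟩
      λ₁ * ((A * s + B * t) * (C * s + D * t))
        ≡⟨ cong₂ (λ x y → λ₁ * (x * y)) (pulled-back α β) (pulled-back γ δ) ⟩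
      λ₁ * (form α β s t * form γ δ s t) ∎
      where
      A = α * a + β * c
      B = α * b + β * d
      C = γ * a + δ * c
      D = γ * b + δ * d
      w = quadratic A B C D
      pulled-back : ∀ α β → (α * a + β * c) * s + (α * b + β * d) * t ≡ form α β s t
      pulled-back α β = solve 8 (λ α β a b c d s t → (α :* a :+ β :* c) :* s :+ (α :* b :+ β :* d) :* t
        := α :* (a :* s :+ b :* t) :+ β :* (c :* s :+ d :* t)) refl α β a b c d s t

    dot-cubic : ∀ {p s t λ₁ μ} α β γ δ ε ζ →
      (∀ i → p i ≡ λ₁ * conicPt s t i + μ * cubicPt (φs s t) (φt s t) i) →
      dot (cubic α β γ δ ε ζ) p ≡ μ * (form α β s t * form γ δ s t * form ε ζ s t)
    dot-cubic {p} {s} {t} {λ₁} {μ} α β γ δ ε ζ e = begin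
      dot w p
        ≡⟨ dot-combination w λ₁ μ (conicPt s t) (cubicPt (φs s t) (φt s t)) e ⟩
      λ₁ * dot w (conicPt s t) + μ * dot w (cubicPt (φs s t) (φt s t))
        ≡⟨ cong₂ (λ x y → λ₁ * x + μ * y) (cubic-conic α β γ δ ε ζ s t) (cubic-cubic α β γ δ ε ζ (φs s t) (φt s t)) ⟩
      λ₁ * 0# + μ * (form α β s t * form γ δ s t * form ε ζ s t)
        ≡⟨ trans (cong (_+ μ * (form α β s t * form γ δ s t * form ε ζ s t)) (zeroʳ λ₁)) (+-identityˡ _) ⟩
      μ * (form α β s t * form γ δ s t * form ε ζ s t) ∎
      where w = cubic α β γ δ ε ζ

    -- The value λ f + μ k at a point of a generator, with the quadratic f and the cubic k expressed
    -- through L = l(s , t) and L′ = l′(s , t).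
    evaluate : (Fin 7 → F) → (λ₁ μ L L′ : F) → F
    evaluate x λ₁ μ L L′ =
      λ₁ * (x 0F * (L′ * L′) + x 1F * (L * L′) + x 2F * (L * L)) +
      μ * (x 3F * (L′ * L′ * L′) + x 4F * (L * L′ * L′) + x 5F * (L * L * L′) + x 6F * (L * L * L))

    dot-functional-generator : ∀ x {p s t λ₁ μ} →
      (∀ i → p i ≡ λ₁ * conicPt s t i + μ * cubicPt (φs s t) (φt s t) i) →
      dot (functional x) p ≡ evaluate x λ₁ μ (l s t) (l′ s t)
    dot-functional-generator x {p} {s} {t} {λ₁} {μ} e = begin
      dot (functional x) p
        ≡⟨ dot-functional x p ⟩
      ∑ (λ k → x k * dot (basis k) p)
        ≡⟨ ∑-cong (λ k → cong (x k *_) (dot-basis k)) ⟩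
      ∑ (λ k → x k * values k)
        ≡⟨ regroup λ₁ μ (x 0F) (x 1F) (x 2F) (x 3F) (x 4F) (x 5F) (x 6F)
             (L′ * L′) (L * L′) (L * L) (L′ * L′ * L′) (L * L′ * L′) (L * L * L′) (L * L * L) ⟩
      evaluate x λ₁ μ L L′ ∎
      where
      L = l s t
      L′ = l′ s t
      -- The identity in sixteen variables is verified in pieces, three terms at a time.
      combine₃ : ∀ k x₀ x₁ x₂ y₀ y₁ y₂ z →
        x₀ * (k * y₀) + (x₁ * (k * y₁) + (x₂ * (k * y₂) + z)) ≡ k * (x₀ * y₀ + x₁ * y₁ + x₂ * y₂) + z
      combine₃ = solve 8 (λ k x₀ x₁ x₂ y₀ y₁ y₂ z →
        x₀ :* (k :* y₀) :+ (x₁ :* (k :* y₁) :+ (x₂ :* (k :* y₂) :+ z))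
        := k :* (x₀ :* y₀ :+ x₁ :* y₁ :+ x₂ :* y₂) :+ z) refl
      regroup : ∀ k m x₀ x₁ x₂ x₃ x₄ x₅ x₆ y₀ y₁ y₂ y₃ y₄ y₅ y₆ →
        x₀ * (k * y₀) + (x₁ * (k * y₁) + (x₂ * (k * y₂) +
          (x₃ * (m * y₃) + (x₄ * (m * y₄) + (x₅ * (m * y₅) + (x₆ * (m * y₆) + 0#))))))
        ≡ k * (x₀ * y₀ + x₁ * y₁ + x₂ * y₂) + m * (x₃ * y₃ + x₄ * y₄ + x₅ * y₅ + x₆ * y₆)
      regroup k m x₀ x₁ x₂ x₃ x₄ x₅ x₆ y₀ y₁ y₂ y₃ y₄ y₅ y₆ =
        trans (combine₃ k x₀ x₁ x₂ y₀ y₁ y₂ _) (cong (k * (x₀ * y₀ + x₁ * y₁ + x₂ * y₂) +_)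
          (trans (combine₃ m x₃ x₄ x₅ y₃ y₄ y₅ _)
                 (solve 4 (λ m u x y → m :* u :+ (x :* (m :* y) :+ 𝟘) := m :* (u :+ x :* y)) refl
                    m (x₃ * y₃ + x₄ * y₄ + x₅ * y₅) x₆ y₆)))
      values : Fin 7 → F
      values = λ₁ * (L′ * L′) ∷ λ₁ * (L * L′) ∷ λ₁ * (L * L) ∷
        μ * (L′ * L′ * L′) ∷ μ * (L * L′ * L′) ∷ μ * (L * L * L′) ∷ μ * (L * L * L) ∷ []
      dot-basis : ∀ k → dot (basis k) p ≡ values k
      dot-basis 0F = dot-quadratic γ δ γ δ e
      dot-basis 1F = dot-quadratic α β γ δ e
      dot-basis 2F = dot-quadratic α β α β e
      dot-basis 3F = dot-cubic γ δ γ δ γ δ e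
      dot-basis 4F = dot-cubic α β γ δ γ δ e
      dot-basis 5F = dot-cubic α β α β γ δ e
      dot-basis 6F = dot-cubic α β α β α β e

  -- When the coefficients of l′² and l′³ are zero, this replaces one factor l by l′ in both forms.
  -- The coefficients of each form move one place down and zero enters at the top.
  shift : (Fin 7 → F) → Fin 7 → F
  shift x = x 1F ∷ x 2F ∷ 0# ∷ x 4F ∷ x 5F ∷ x 6F ∷ 0# ∷ []

-- Counting in finite sets

avoiding : ∀ {m q} → m < q → (b₁ b₂ : Fin (suc q)) → b₁ ≢ b₂ →
  Σ (Fin m → Fin (suc q)) λ ρ → (∀ {i j} → ρ i ≡ ρ j → i ≡ j) × (∀ j → b₁ ≢ ρ j × b₂ ≢ ρ j)
avoiding {q = suc n} (s≤s m≤n) b₁ b₂ b₁≢b₂ =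
  (λ j → punchIn b₁ (punchIn b₂′ (Fin.inject≤ j m≤n))) ,
  (λ e → Fin.inject≤-injective m≤n m≤n _ _
    (Fin.punchIn-injective b₂′ _ _ (Fin.punchIn-injective b₁ _ _ e))) ,
  λ j → (λ e → Fin.punchInᵢ≢i b₁ _ (sym e)) , λ e → Fin.punchInᵢ≢i b₂′ _
    (Fin.punchIn-injective b₁ _ _ (trans (sym e) (sym (Fin.punchIn-punchOut b₁≢b₂))))
  where
  -- The position of `b₂` once `b₁` has been deleted. After both deletions q - 1 indices remain.
  b₂′ = punchOut b₁≢b₂

-- Deleting a missed value from the codomain would leave an injection into a smaller set.
injective⇒surjective : ∀ {n} (f : Fin n → Fin n) → (∀ {i j} → f i ≡ f j → i ≡ j) → ∀ y → ∃ λ x → f x ≡ y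
injective⇒surjective {suc n} f inj y with Fin.any? (λ x → f x Fin.≟ y)
... | yes hit = hit
... | no miss = contradiction
  (Fin.injective⇒≤ {f = λ x → punchOut (λ e → miss (x , sym e))}
    (λ {i} {j} e → inj (Fin.punchOut-injective {i = y} {f i} {f j} _ _ e)))
  ℕ.1+n≰n

-- At most two points of the curve on a line

module CurveOnSurface {q : ℕ} (𝔽 : FiniteField q) (φ : Geometry.PGL2 𝔽) {r : ℕ}
  (2≤r : 2 ≤ r) (r≤5 : r ≤ 5) (7≤q : 7 ≤ q)
  (v : Fin (suc r) → Geometry.V7 𝔽) (lin : Geometry.LinIndep 𝔽 v) where
  open FiniteField 𝔽
  open Geometry 𝔽
  open Surface φ
  open PGL2 φ
  open FieldLemmas 𝔽
  open LinearAlgebra 𝔽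
  open ProjectiveLine 𝔽
  open Functionals 𝔽
  open NormalRationalCurve 𝔽 v
  open Generators 𝔽 φ
  open ≡-Reasoning

  pair-independent : ∀ {b₁ b₂} → b₁ ≢ b₂ → ∀ x y →
    (∀ c → x * curvePoint b₁ c + y * curvePoint b₂ c ≡ 0#) → x ≡ 0# × y ≡ 0#
  pair-independent {b₁} {b₂} b₁≢b₂ x y relation = all-zero 0F , all-zero 1F
    where
    injective : Injective (b₁ ∷ b₂ ∷ [])
    injective {0F} {0F} e = refl
    injective {0F} {1F} e = contradiction e b₁≢b₂
    injective {1F} {0F} e = contradiction (sym e) b₁≢b₂
    injective {1F} {1F} e = refl
    all-zero : ∀ j → (x ∷ y ∷ []) j ≡ 0#
    all-zero = curvePoints-independent lin (ℕ.≤-trans 2≤r (ℕ.n≤1+n r)) (b₁ ∷ b₂ ∷ []) injective (x ∷ y ∷ [])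
      (λ c → trans (cong (x * curvePoint b₁ c +_) (+-identityʳ _)) (relation c))

  triple-independent : ∀ {b₁ b₂ b₃} → b₁ ≢ b₂ → b₁ ≢ b₃ → b₂ ≢ b₃ → ∀ x y z →
    (∀ c → x * curvePoint b₁ c + (y * curvePoint b₂ c + z * curvePoint b₃ c) ≡ 0#) → z ≡ 0#
  triple-independent {b₁} {b₂} {b₃} b₁≢b₂ b₁≢b₃ b₂≢b₃ x y z relation =
    curvePoints-independent lin (s≤s 2≤r) (b₁ ∷ b₂ ∷ b₃ ∷ []) injective (x ∷ y ∷ z ∷ [])
      (λ c → trans (cong (λ u → x * curvePoint b₁ c + (y * curvePoint b₂ c + u)) (+-identityʳ _)) (relation c)) 2F
    where
    injective : Injective (b₁ ∷ b₂ ∷ b₃ ∷ [])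
    injective {0F} {0F} e = refl
    injective {0F} {1F} e = contradiction e b₁≢b₂
    injective {0F} {2F} e = contradiction e b₁≢b₃
    injective {1F} {0F} e = contradiction (sym e) b₁≢b₂
    injective {1F} {1F} e = refl
    injective {1F} {2F} e = contradiction e b₂≢b₃
    injective {2F} {0F} e = contradiction (sym e) b₁≢b₃
    injective {2F} {1F} e = contradiction (sym e) b₂≢b₃
    injective {2F} {2F} e = refl

  module OnLine (P Q : V7) where
    OnPQ : F → F → V7 → Set
    OnPQ x y p = ∀ c → p c ≡ x * P c + y * Q c

    -- If the determinant were zero, x₂ p₁ - x₁ p₂ and y₂ p₁ - y₁ p₂ would both vanish. Independence
    -- of the two curve points then gives x₁ = y₁ = 0, so the first point would be the zero vector.
    coordinates-independent : ∀ {b₁ b₂ x₁ y₁ x₂ y₂} → b₁ ≢ b₂ →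
      OnPQ x₁ y₁ (curvePoint b₁) → OnPQ x₂ y₂ (curvePoint b₂) → bracket x₁ y₁ x₂ y₂ ≢ 0#
    coordinates-independent {b₁} {b₂} {x₁} {y₁} {x₂} {y₂} b₁≢b₂ e₁ e₂ Δ≡0 = 0≢1 (sym (proj₁
      (pair-independent b₁≢b₂ 1# 0# (λ c → trans
        (cong₂ _+_ (trans (*-identityˡ _) (trans (e₁ c)
            (trans (cong₂ (λ x y → x * P c + y * Q c) x₁≡0 y₁≡0) (cong₂ _+_ (zeroˡ (P c)) (zeroˡ (Q c))))))
          (zeroˡ _))
        (trans (cong (_+ 0#) (+-identityˡ 0#)) (+-identityˡ 0#))))))
      where
      negated : ∀ {x} → - x ≡ 0# → x ≡ 0#
      negated {x} -x≡0 = begin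
        x         ≡⟨ solve 1 (λ x → x := :- (:- x)) refl x ⟩
        - (- x)   ≡⟨ cong -_ -x≡0 ⟩
        - 0#      ≡⟨ solve 0 (:- 𝟘 := 𝟘) refl ⟩
        0#        ∎
      x₁≡0 : x₁ ≡ 0#
      x₁≡0 = negated (proj₂ (pair-independent b₁≢b₂ x₂ (- x₁) (λ c → begin
        x₂ * curvePoint b₁ c + - x₁ * curvePoint b₂ c
          ≡⟨ cong₂ (λ p p′ → x₂ * p + - x₁ * p′) (e₁ c) (e₂ c) ⟩
        x₂ * (x₁ * P c + y₁ * Q c) + - x₁ * (x₂ * P c + y₂ * Q c)
          ≡⟨ solve 6 (λ x₁ y₁ x₂ y₂ p q → x₂ :* (x₁ :* p :+ y₁ :* q) :+ :- x₁ :* (x₂ :* p :+ y₂ :* q)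
               := (x₁ :* y₂ :+ :- (y₁ :* x₂)) :* (:- q)) refl x₁ y₁ x₂ y₂ (P c) (Q c) ⟩
        bracket x₁ y₁ x₂ y₂ * (- Q c)
          ≡⟨ trans (cong (_* (- Q c)) Δ≡0) (zeroˡ (- Q c)) ⟩
        0# ∎)))
      y₁≡0 : y₁ ≡ 0#
      y₁≡0 = negated (proj₂ (pair-independent b₁≢b₂ y₂ (- y₁) (λ c → begin
        y₂ * curvePoint b₁ c + - y₁ * curvePoint b₂ c
          ≡⟨ cong₂ (λ p p′ → y₂ * p + - y₁ * p′) (e₁ c) (e₂ c) ⟩
        y₂ * (x₁ * P c + y₁ * Q c) + - y₁ * (x₂ * P c + y₂ * Q c)
          ≡⟨ solve 6 (λ x₁ y₁ x₂ y₂ p q → y₂ :* (x₁ :* p :+ y₁ :* q) :+ :- y₁ :* (x₂ :* p :+ y₂ :* q)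
               := (x₁ :* y₂ :+ :- (y₁ :* x₂)) :* p) refl x₁ y₁ x₂ y₂ (P c) (Q c) ⟩
        bracket x₁ y₁ x₂ y₂ * P c
          ≡⟨ trans (cong (_* P c) Δ≡0) (zeroˡ (P c)) ⟩
        0# ∎)))

    -- Three vectors with two coordinates satisfy the Cramer relation, whose coefficients are the
    -- brackets of the pairs. Three curve points being independent, the bracket of the first two
    -- vanishes, against `coordinates-independent`.
    at-most-two : ∀ {b₁ b₂ b₃ x₁ y₁ x₂ y₂ x₃ y₃} → b₁ ≢ b₂ → b₁ ≢ b₃ → b₂ ≢ b₃ →
      OnPQ x₁ y₁ (curvePoint b₁) → OnPQ x₂ y₂ (curvePoint b₂) → OnPQ x₃ y₃ (curvePoint b₃) → ⊥
    at-most-two {b₁} {b₂} {b₃} {x₁} {y₁} {x₂} {y₂} {x₃} {y₃} b₁≢b₂ b₁≢b₃ b₂≢b₃ e₁ e₂ e₃ =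
      coordinates-independent b₁≢b₂ e₁ e₂
        (triple-independent b₁≢b₂ b₁≢b₃ b₂≢b₃ (bracket x₂ y₂ x₃ y₃) (bracket x₃ y₃ x₁ y₁) (bracket x₁ y₁ x₂ y₂)
          (λ c → trans
            (cong₂ (λ p u → bracket x₂ y₂ x₃ y₃ * p + u) (e₁ c)
              (cong₂ (λ p p′ → bracket x₃ y₃ x₁ y₁ * p + bracket x₁ y₁ x₂ y₂ * p′) (e₂ c) (e₃ c)))
            (cramer x₁ y₁ x₂ y₂ x₃ y₃ (P c) (Q c))))
      where
      cramer : ∀ x₁ y₁ x₂ y₂ x₃ y₃ p q →
        bracket x₂ y₂ x₃ y₃ * (x₁ * p + y₁ * q) +
        (bracket x₃ y₃ x₁ y₁ * (x₂ * p + y₂ * q) + bracket x₁ y₁ x₂ y₂ * (x₃ * p + y₃ * q)) ≡ 0#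
      cramer = solve 8 (λ x₁ y₁ x₂ y₂ x₃ y₃ p q →
        (x₂ :* y₃ :+ :- (y₂ :* x₃)) :* (x₁ :* p :+ y₁ :* q) :+
        ((x₃ :* y₁ :+ :- (y₃ :* x₁)) :* (x₂ :* p :+ y₂ :* q) :+ (x₁ :* y₂ :+ :- (y₁ :* x₂)) :* (x₃ :* p :+ y₃ :* q))
        := 𝟘) refl

    -- A functional taking the values X and Y at P and Q and vanishing at two points of the line.
    values-vanish : ∀ {x₁ y₁ x₂ y₂ X Y} → bracket x₁ y₁ x₂ y₂ ≢ 0# →
      x₁ * X + y₁ * Y ≡ 0# → x₂ * X + y₂ * Y ≡ 0# → X ≡ 0# × Y ≡ 0#
    values-vanish {x₁} {y₁} {x₂} {y₂} {X} {Y} Δ≢0 e₁ e₂ =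
      x*y≡0⇒y≡0 Δ≢0 (begin
        bracket x₁ y₁ x₂ y₂ * X
          ≡⟨ solve 6 (λ x₁ y₁ x₂ y₂ X Y → (x₁ :* y₂ :+ :- (y₁ :* x₂)) :* X
               := y₂ :* (x₁ :* X :+ y₁ :* Y) :+ :- y₁ :* (x₂ :* X :+ y₂ :* Y)) refl x₁ y₁ x₂ y₂ X Y ⟩
        y₂ * (x₁ * X + y₁ * Y) + - y₁ * (x₂ * X + y₂ * Y)
          ≡⟨ zero-combination y₂ (- y₁) ⟩
        0# ∎) ,
      x*y≡0⇒y≡0 Δ≢0 (begin
        bracket x₁ y₁ x₂ y₂ * Y
          ≡⟨ solve 6 (λ x₁ y₁ x₂ y₂ X Y → (x₁ :* y₂ :+ :- (y₁ :* x₂)) :* Y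
               := :- x₂ :* (x₁ :* X :+ y₁ :* Y) :+ x₁ :* (x₂ :* X :+ y₂ :* Y)) refl x₁ y₁ x₂ y₂ X Y ⟩
        - x₂ * (x₁ * X + y₁ * Y) + x₁ * (x₂ * X + y₂ * Y)
          ≡⟨ zero-combination (- x₂) x₁ ⟩
        0# ∎)
      where
      zero-combination : ∀ u w → u * (x₁ * X + y₁ * Y) + w * (x₂ * X + y₂ * Y) ≡ 0#
      zero-combination u w = begin
        u * (x₁ * X + y₁ * Y) + w * (x₂ * X + y₂ * Y)  ≡⟨ cong₂ (λ a b → u * a + w * b) e₁ e₂ ⟩
        u * 0# + w * 0#                                ≡⟨ cong₂ _+_ (zeroʳ u) (zeroʳ w) ⟩
        0# + 0#                                        ≡⟨ +-identityˡ 0# ⟩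
        0#                                             ∎

  -- Contradiction from two points of the curve on one generator

  module TwoPointsOnGenerator (onV : ∀ j → OnV (curvePoint j)) {b₁ b₂ g} (b₁≢b₂ : b₁ ≢ b₂)
    (on₁ : OnGenerator (pointₛ g) (pointₜ g) (curvePoint b₁))
    (on₂ : OnGenerator (pointₛ g) (pointₜ g) (curvePoint b₂)) where

    s₀ t₀ S₀ T₀ : F
    s₀ = pointₛ g
    t₀ = pointₜ g
    S₀ = φs s₀ t₀
    T₀ = φt s₀ t₀

    transverse : ∃ λ x → ∃ λ y → x * S₀ + y * T₀ ≢ 0#
    transverse = transverse-form (φ-nonzero s₀ t₀ (point-nonzero g))

    -- Here l is T₀ S - S₀ T, which vanishes at the parameter of g, and l′ is a form that does not.
    open Basis T₀ (- S₀) (proj₁ transverse) (proj₁ (proj₂ transverse))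
    open OnLine (conicPt s₀ t₀) (cubicPt S₀ T₀)

    l≡0 : l s₀ t₀ ≡ 0#
    l≡0 = solve 2 (λ S T → T :* S :+ :- S :* T := 𝟘) refl S₀ T₀

    l′≢0 : l′ s₀ t₀ ≢ 0#
    l′≢0 = proj₂ (proj₂ transverse)

    l≢0 : ∀ {h} → g ≢ h → l (pointₛ h) (pointₜ h) ≢ 0#
    l≢0 {h} g≢h l≡0 = *-nonzero det≢0 (point-distinct g h g≢h) (begin
      (a * d + - (b * c)) * β          ≡⟨ solve 2 (λ D β → D :* β := :- (:- D :* β)) refl (a * d + - (b * c)) β ⟩
      - (- (a * d + - (b * c)) * β)    ≡⟨ cong -_ (form-bracket s₀ t₀ (pointₛ h) (pointₜ h)) ⟨
      - l (pointₛ h) (pointₜ h)        ≡⟨ cong -_ l≡0 ⟩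
      - 0#                             ≡⟨ solve 0 (:- 𝟘 := 𝟘) refl ⟩
      0#                               ∎)
      where β = bracket s₀ t₀ (pointₛ h) (pointₜ h)

    Vanishes : (Fin 7 → F) → Set
    Vanishes x = ∀ j → dot (functional x) (curvePoint j) ≡ 0#

    evaluate-L≡0 : ∀ x λ₁ μ {L} L′ → L ≡ 0# →
      evaluate x λ₁ μ L L′ ≡ λ₁ * (L′ * L′ * x 0F) + μ * (L′ * L′ * L′ * x 3F)
    evaluate-L≡0 x λ₁ μ L′ refl = cong₂ (λ X Y → λ₁ * X + μ * Y)
      (solve 4 (λ x₀ x₁ x₂ L′ → x₀ :* (L′ :* L′) :+ x₁ :* (𝟘 :* L′) :+ x₂ :* (𝟘 :* 𝟘) := L′ :* L′ :* x₀)
         refl (x 0F) (x 1F) (x 2F) L′)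
      (solve 5 (λ x₃ x₄ x₅ x₆ L′ →
          x₃ :* (L′ :* L′ :* L′) :+ x₄ :* (𝟘 :* L′ :* L′) :+ x₅ :* (𝟘 :* 𝟘 :* L′) :+ x₆ :* (𝟘 :* 𝟘 :* 𝟘)
          := L′ :* L′ :* L′ :* x₃)
         refl (x 3F) (x 4F) (x 5F) (x 6F) L′)

    -- On g the form l is zero, so only the terms in l′² and l′³ survive. Vanishing at two points
    -- with independent coordinates on g kills both.
    leading≡0 : ∀ x → Vanishes x → x 0F ≡ 0# × x 3F ≡ 0#
    leading≡0 x vanishes =
      let λ₁ , μ₁ , e₁ = on₁
          λ₂ , μ₂ , e₂ = on₂
          X≡0 , Y≡0 = values-vanish (coordinates-independent b₁≢b₂ e₁ e₂) (at b₁ e₁) (at b₂ e₂)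
      in x*y≡0⇒y≡0 L′²≢0 X≡0 , x*y≡0⇒y≡0 (*-nonzero L′²≢0 l′≢0) Y≡0
      where
      L′ = l′ s₀ t₀
      L′²≢0 : L′ * L′ ≢ 0#
      L′²≢0 = *-nonzero l′≢0 l′≢0
      at : ∀ j {λ₁ μ} → OnPQ λ₁ μ (curvePoint j) →
           λ₁ * (L′ * L′ * x 0F) + μ * (L′ * L′ * L′ * x 3F) ≡ 0#
      at j {λ₁} {μ} e = begin
        λ₁ * (L′ * L′ * x 0F) + μ * (L′ * L′ * L′ * x 3F)  ≡⟨ evaluate-L≡0 x λ₁ μ L′ l≡0 ⟨
        evaluate x λ₁ μ (l s₀ t₀) L′                       ≡⟨ dot-functional-generator x e ⟨
        dot (functional x) (curvePoint j)                  ≡⟨ vanishes j ⟩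
        0#                                                 ∎

    -- Exchanging a factor l for l′, stated without division; off g the factor L is non-zero and can
    -- be cancelled.
    evaluate-shift : ∀ x λ₁ μ L L′ → x 0F ≡ 0# → x 3F ≡ 0# →
      L * evaluate (shift x) λ₁ μ L L′ ≡ L′ * evaluate x λ₁ μ L L′
    evaluate-shift x λ₁ μ L L′ x₀≡0 x₃≡0 = begin
      L * (λ₁ * X⁺ + μ * Y⁺)          ≡⟨ solve 5 (λ k u X m Y → k :* (u :* X :+ m :* Y) := u :* (k :* X) :+ m :* (k :* Y))
                                           refl L λ₁ X⁺ μ Y⁺ ⟩
      λ₁ * (L * X⁺) + μ * (L * Y⁺)    ≡⟨ cong₂ (λ X Y → λ₁ * X + μ * Y) conic-part cubic-part ⟩
      λ₁ * (L′ * X) + μ * (L′ * Y)    ≡⟨ solve 5 (λ k u X m Y → u :* (k :* X) :+ m :* (k :* Y) := k :* (u :* X :+ m :* Y))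
                                           refl L′ λ₁ X μ Y ⟩
      L′ * (λ₁ * X + μ * Y)           ∎
      where
      X⁺ = x 1F * (L′ * L′) + x 2F * (L * L′) + 0# * (L * L)
      X = x 0F * (L′ * L′) + x 1F * (L * L′) + x 2F * (L * L)
      Y⁺ = x 4F * (L′ * L′ * L′) + x 5F * (L * L′ * L′) + x 6F * (L * L * L′) + 0# * (L * L * L)
      Y = x 3F * (L′ * L′ * L′) + x 4F * (L * L′ * L′) + x 5F * (L * L * L′) + x 6F * (L * L * L)
      conic-part : L * X⁺ ≡ L′ * X
      conic-part = trans
        (solve 4 (λ x₁ x₂ L L′ →
          L :* (x₁ :* (L′ :* L′) :+ x₂ :* (L :* L′) :+ 𝟘 :* (L :* L))
          := L′ :* (𝟘 :* (L′ :* L′) :+ x₁ :* (L :* L′) :+ x₂ :* (L :* L))) refl (x 1F) (x 2F) L L′)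
        (cong (λ x₀ → L′ * (x₀ * (L′ * L′) + x 1F * (L * L′) + x 2F * (L * L))) (sym x₀≡0))
      cubic-part : L * Y⁺ ≡ L′ * Y
      cubic-part = trans
        (solve 5 (λ x₄ x₅ x₆ L L′ →
          L :* (x₄ :* (L′ :* L′ :* L′) :+ x₅ :* (L :* L′ :* L′) :+ x₆ :* (L :* L :* L′) :+ 𝟘 :* (L :* L :* L))
          := L′ :* (𝟘 :* (L′ :* L′ :* L′) :+ x₄ :* (L :* L′ :* L′) :+ x₅ :* (L :* L :* L′) :+ x₆ :* (L :* L :* L)))
          refl (x 4F) (x 5F) (x 6F) L L′)
        (cong (λ x₃ → L′ * (x₃ * (L′ * L′ * L′) + x 4F * (L * L′ * L′) + x 5F * (L * L * L′) + x 6F * (L * L * L))) (sym x₃≡0))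

    generator-differs : ∀ {j h} → b₁ ≢ j → b₂ ≢ j → OnGenerator (pointₛ h) (pointₜ h) (curvePoint j) → g ≢ h
    generator-differs b₁≢j b₂≢j on refl =
      at-most-two b₁≢b₂ b₁≢j b₂≢j (proj₂ (proj₂ on₁)) (proj₂ (proj₂ on₂)) (proj₂ (proj₂ on))

    -- The new functional vanishes at the curve points off g by `evaluate-shift`, and these are
    -- numerous enough to propagate the vanishing to the two points on g.
    shift-vanishes : ∀ x → Vanishes x → Vanishes (shift x)
    shift-vanishes x vanishes =
      -- The r + 1 parameters are chosen among the q - 1 other than `b₁` and `b₂`; this is possible
      -- as r + 2 ≤ 7 ≤ q.
      let ρ , injective , avoids = avoiding (ℕ.≤-trans (s≤s (s≤s r≤5)) 7≤q) b₁ b₂ b₁≢b₂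
      in vanishing-propagates (functional (shift x)) ρ injective
           (λ j → off-generator (ρ j) (proj₁ (avoids j)) (proj₂ (avoids j)))
      where
      x₀≡0 : x 0F ≡ 0#
      x₀≡0 = proj₁ (leading≡0 x vanishes)
      x₃≡0 : x 3F ≡ 0#
      x₃≡0 = proj₂ (leading≡0 x vanishes)
      on-other-generator : ∀ j h → g ≢ h → OnGenerator (pointₛ h) (pointₜ h) (curvePoint j) →
        dot (functional (shift x)) (curvePoint j) ≡ 0#
      on-other-generator j h g≢h (λ₁ , μ , e) = x*y≡0⇒y≡0 (l≢0 g≢h) (begin
        L * dot (functional (shift x)) (curvePoint j)  ≡⟨ cong (L *_) (dot-functional-generator (shift x) e) ⟩
        L * evaluate (shift x) λ₁ μ L L′               ≡⟨ evaluate-shift x λ₁ μ L L′ x₀≡0 x₃≡0 ⟩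
        L′ * evaluate x λ₁ μ L L′                      ≡⟨ cong (L′ *_) (dot-functional-generator x e) ⟨
        L′ * dot (functional x) (curvePoint j)         ≡⟨ cong (L′ *_) (vanishes j) ⟩
        L′ * 0#                                        ≡⟨ zeroʳ L′ ⟩
        0#                                             ∎)
        where
        L = l (pointₛ h) (pointₜ h)
        L′ = l′ (pointₛ h) (pointₜ h)
      off-generator : ∀ j → b₁ ≢ j → b₂ ≢ j → dot (functional (shift x)) (curvePoint j) ≡ 0#
      off-generator j b₁≢j b₂≢j = let h , on = OnV⇒OnGenerator (onV j) in
        on-other-generator j h (generator-differs b₁≢j b₂≢j on) on

    -- After n shifts the leading coefficients are the n-th ones of the quadratic and of the cubic.
    -- Two shifts exhaust the quadratic, three the cubic.
    vanishing⇒zero : ∀ x → Vanishes x → ∀ k → x k ≡ 0#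
    vanishing⇒zero x x-vanishes = λ where
        0F → proj₁ (leading≡0 x x-vanishes)
        1F → proj₁ (leading≡0 x¹ x¹-vanishes)
        2F → proj₁ (leading≡0 x² x²-vanishes)
        3F → proj₂ (leading≡0 x x-vanishes)
        4F → proj₂ (leading≡0 x¹ x¹-vanishes)
        5F → proj₂ (leading≡0 x² x²-vanishes)
        6F → proj₂ (leading≡0 x³ x³-vanishes)
      where
      x¹ = shift x
      x² = shift x¹
      x³ = shift x²
      x¹-vanishes : Vanishes x¹
      x¹-vanishes = shift-vanishes x x-vanishes
      x²-vanishes : Vanishes x²
      x²-vanishes = shift-vanishes x¹ x¹-vanishes
      x³-vanishes : Vanishes x³
      x³-vanishes = shift-vanishes x² x²-vanishes

    -- Every curve point is a combination of the `v i`, so r + 1 linear conditions on `x` suffice.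
    vanishes-on-curve : ∀ x → (∀ i → ∑ (λ k → dot (basis k) (v i) * x k) ≡ 0#) → Vanishes x
    vanishes-on-curve x sol j = begin
      dot (functional x) (curvePoint j)
        ≡⟨ dot-∑ (functional x) (monomial (pointₛ j) (pointₜ j)) v (λ c → refl) ⟩
      ∑ (λ i → monomial (pointₛ j) (pointₜ j) i * dot (functional x) (v i))
        ≡⟨ ∑-zero (λ i → trans (cong (monomial (pointₛ j) (pointₜ j) i *_)
             (trans (dot-functional x (v i)) (trans (∑-cong (λ k → *-comm (x k) (dot (basis k) (v i)))) (sol i))))
             (zeroʳ (monomial (pointₛ j) (pointₜ j) i))) ⟩
      0# ∎

    impossible : ⊥
    impossible =
      -- There are r + 1 ≤ 6 equations in the seven coefficients, hence a non-zero solution.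
      let x , (k , xₖ≢0) , sol = homogeneous-system (s≤s (s≤s r≤5)) (λ i k → dot (basis k) (v i))
      in xₖ≢0 (vanishing⇒zero x (vanishes-on-curve x sol) k)

-- From at most one point on each generator to exactly one, by counting

theorem2p9 : ∀ {q : ℕ} (𝔽 : FiniteField q) → 6 ≤ q →
    let open FiniteField 𝔽 in let open Geometry 𝔽 in
    (φ : PGL2) → let open Surface φ in
    (r : ℕ) → 3 ≤ r → r ≤ 5 →
    (v : Fin (suc r) → V7) → LinIndep v →
    (∀ s t → NonZero2 s t → OnV (nrcPt r v s t)) →
    ∀ s t → NonZero2 s t →
    Σ F (λ u → Σ F (λ w → NonZero2 u w × OnGenerator s t (nrcPt r v u w)))
    × (∀ u w u′ w′ → NonZero2 u w → NonZero2 u′ w′ →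
    OnGenerator s t (nrcPt r v u w) → OnGenerator s t (nrcPt r v u′ w′) →
    SamePoint (nrcPt r v u w) (nrcPt r v u′ w′))
theorem2p9 {q} 𝔽 6≤q φ r 3≤r r≤5 v lin onV s t nonzero = existence , uniqueness
  where
  open FiniteField 𝔽
  open Geometry 𝔽
  open Surface φ
  open FieldLemmas 𝔽
  open LinearAlgebra 𝔽
  open ProjectiveLine 𝔽
  open NormalRationalCurve 𝔽 v
  open Generators 𝔽 φ
  open ≡-Reasoning

  curve-onV : ∀ j → OnV (curvePoint j)
  curve-onV j = onV (pointₛ j) (pointₜ j) (point-nonzero j)

  at-most-one : ∀ {g i j} → OnGenerator (pointₛ g) (pointₜ g) (curvePoint i) →
    OnGenerator (pointₛ g) (pointₜ g) (curvePoint j) → i ≡ j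
  at-most-one {g} {i} {j} onᵢ onⱼ = decidable-stable (i Fin.≟ j) (λ i≢j →
    CurveOnSurface.TwoPointsOnGenerator.impossible 𝔽 φ (ℕ.≤-trans (ℕ.n≤1+n 2) 3≤r) r≤5
      (FieldOrder.6≤order⇒7≤order 𝔽 6≤q) v lin curve-onV {g = g} i≢j onᵢ onⱼ)

  -- A choice of generator through each curve point. By `at-most-one` it is injective, hence a
  -- bijection between the q + 1 parameters of the curve and the q + 1 generators.
  gen : Fin (suc q) → Fin (suc q)
  gen j = proj₁ (OnV⇒OnGenerator (curve-onV j))

  on-gen : ∀ j → OnGenerator (pointₛ (gen j)) (pointₜ (gen j)) (curvePoint j)
  on-gen j = proj₂ (OnV⇒OnGenerator (curve-onV j))

  gen-injective : ∀ {i j} → gen i ≡ gen j → i ≡ j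
  gen-injective {i} {j} e = at-most-one {gen j}
    (subst (λ g → OnGenerator (pointₛ g) (pointₜ g) (curvePoint i)) e (on-gen i)) (on-gen j)

  existence : Σ F (λ u → Σ F (λ w → NonZero2 u w × OnGenerator s t (nrcPt r v u w)))
  existence =
    let g , k , k≢0 , s≡ , t≡ = normalise nonzero
        -- The pair (s , t) is k times its representative, while membership is transported from the
        -- representative to (s , t).
        k⁻¹ , kk⁻¹≡1 = inverse k k≢0
        j , gen≡g = injective⇒surjective gen gen-injective g
    in pointₛ j , pointₜ j , point-nonzero j ,
       OnGenerator-scale k⁻¹ {p = curvePoint j} (unscale kk⁻¹≡1 s≡) (unscale kk⁻¹≡1 t≡)
         (subst (λ g → OnGenerator (pointₛ g) (pointₜ g) (curvePoint j)) gen≡g (on-gen j))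

  uniqueness : ∀ u w u′ w′ → NonZero2 u w → NonZero2 u′ w′ →
    OnGenerator s t (nrcPt r v u w) → OnGenerator s t (nrcPt r v u′ w′) →
    SamePoint (nrcPt r v u w) (nrcPt r v u′ w′)
  uniqueness u w u′ w′ nonzero₁ nonzero₂ on₁ on₂ =
    let g , k , _ , s≡ , t≡ = normalise nonzero
        i , same₁ = nrcPt-normalise nonzero₁
        j , same₂ = nrcPt-normalise nonzero₂
        p = nrcPt r v u w
        p′ = nrcPt r v u′ w′
        -- Both points and the generator are replaced by their normalised representatives, where
        -- `at-most-one` applies.
        i≡j = at-most-one {g} {i} {j}
          (OnGenerator-respects {p = p} {curvePoint i} same₁ (OnGenerator-scale k {p = p} s≡ t≡ on₁))
          (OnGenerator-respects {p = p′} {curvePoint j} same₂ (OnGenerator-scale k {p = p′} s≡ t≡ on₂))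
    in SamePoint-trans {p} {curvePoint j} {p′}
         (subst (λ i → SamePoint p (curvePoint i)) i≡j same₁) (SamePoint-sym {p′} {curvePoint j} same₂)
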